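{- Let $k \geq 3$ be an integer. Then: (a) for every $A \subseteq \mathbb{N}$, if $D^k(A)$ is dense in $S^{k-1}$, then $D^{k-1}(A)$ is dense in $S^{k-2}$; (b) there exists $A \subseteq \mathbb{N}$ such that $D^k(A)$ is not dense in $S^{k-1}$ but $D^{k-1}(A)$ is dense in $S^{k-2}$.
   Context: $\mathbb{N}$ denotes the set of positive integers and $\|\cdot\|$ the Euclidean norm. For every integer $m \geq 2$, put $S^{m-1} := \{\boldsymbol{x} \in [0,1]^m : \|\boldsymbol{x}\| = 1\}$ (the part of the unit sphere of $\mathbb{R}^m$ with nonnegative coordinates), with the subspace topology from $\mathbb{R}^m$, and for $A \subseteq \mathbb{N}$ put $D^m(A) := \{\boldsymbol{a}/\|\boldsymbol{a}\| : \boldsymbol{a} \in A^m\} \subseteq S^{m-1}$. -}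

module Defs where

open import Level using (0ℓ)
open import Data.Fin using (Fin; zero; suc)
open import Data.Integer.Base as ℤ using (+_)
import Data.Integer.Properties as ℤ
open import Data.Nat as ℕ using (ℕ; zero; suc)
import Data.Nat.Properties as ℕ
import Data.Nat.Solver as ℕ
open import Data.Product using (Σ; Σ-syntax; ∃; ∃-syntax; _×_; _,_; proj₁; proj₂)
open import Data.Rational as ℚ using (ℚ; 0ℚ; 1ℚ; ½; ↥_; ↧ₙ_; ↧_; toℚᵘ; fromℚᵘ; mkℚ)
import Data.Rational.Properties as ℚ
import Data.Rational.Unnormalised as ℚᵘ
import Data.Rational.Unnormalised.Properties as ℚᵘ
open import Data.Rational.Solver using (module +-*-Solver)
open import Data.Sum using (inj₁; inj₂)
open import Data.Vec.Functional using (Vector; foldr; map; zipWith)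
open import Function using (_∘_)
open import Relation.Binary.PropositionalEquality
  using (_≡_; refl; sym; trans; cong; cong₂; subst; subst₂)
open import Relation.Nullary using (yes; no; contradiction)
open import Relation.Unary using (Pred; _∈_)

------------------------------------------------------------------------
-- Rational arithmetic

module RationalLemmas where
  open import Data.Rational

  private
    variable
      p q r ε : ℚ

  ∣p-q∣-sym : ∀ p q → ∣ p - q ∣ ≡ ∣ q - p ∣
  ∣p-q∣-sym p q = trans (sym (ℚ.∣-p∣≡∣p∣ (p - q))) (cong ∣_∣ (eq p q))
    where
    open +-*-Solver
    eq : ∀ p q → - (p - q) ≡ q - p
    eq = solve 2 (λ p q → :- (p :- q) := q :- p) refl

  p≤∣p∣ : ∀ p → p ≤ ∣ p ∣
  p≤∣p∣ p with ℚ.≤-total 0ℚ p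
  ... | inj₁ 0≤p = ℚ.≤-reflexive (sym (ℚ.0≤p⇒∣p∣≡p 0≤p))
  ... | inj₂ p≤0 = ℚ.≤-trans p≤0 (ℚ.0≤∣p∣ p)

  p≤q+∣p-q∣ : ∀ p q → p ≤ q + ∣ p - q ∣
  p≤q+∣p-q∣ p q = subst (_≤ q + ∣ p - q ∣) (eq p q) (ℚ.+-monoʳ-≤ q (p≤∣p∣ (p - q)))
    where
    open +-*-Solver
    eq : ∀ p q → q + (p - q) ≡ p
    eq = solve 2 (λ p q → q :+ (p :- q) := p) refl

  ∣p∣≤∣q∣+∣p-q∣ : ∀ p q → ∣ p ∣ ≤ ∣ q ∣ + ∣ p - q ∣
  ∣p∣≤∣q∣+∣p-q∣ p q =
    subst (λ r → ∣ r ∣ ≤ ∣ q ∣ + ∣ p - q ∣) (eq p q) (ℚ.∣p+q∣≤∣p∣+∣q∣ q (p - q))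
    where
    open +-*-Solver
    eq : ∀ p q → q + (p - q) ≡ p
    eq = solve 2 (λ p q → q :+ (p :- q) := p) refl

  p<q+r⇒p-q<r : ∀ p q r → p < q + r → p - q < r
  p<q+r⇒p-q<r p q r p<q+r = subst (p - q <_) (eq q r) (ℚ.+-monoˡ-< (- q) p<q+r)
    where
    open +-*-Solver
    eq : ∀ q r → q + r - q ≡ r
    eq = solve 2 (λ q r → q :+ r :- q := r) refl

  ∣p-q∣<r : ∀ p q r → p < q + r → q < p + r → ∣ p - q ∣ < r
  ∣p-q∣<r p q r p<q+r q<p+r with ℚ.∣p∣≡p∨∣p∣≡-p (p - q)
  ... | inj₁ eq = subst (_< r) (sym eq) (p<q+r⇒p-q<r p q r p<q+r)
  ... | inj₂ eq = subst (_< r) (sym (trans eq (eq′ p q))) (p<q+r⇒p-q<r q p r q<p+r)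
    where
    open +-*-Solver
    eq′ : ∀ p q → - (p - q) ≡ q - p
    eq′ = solve 2 (λ p q → :- (p :- q) := q :- p) refl

  0<½*p : 0ℚ < p → 0ℚ < ½ * p
  0<½*p {p} 0<p =
    ℚ.positive⁻¹ (½ * p) {{ℚ.pos*pos⇒pos ½ p {{positive 0<p}}}}

  ½*p+½*p≡p : ∀ p → ½ * p + ½ * p ≡ p
  ½*p+½*p≡p p = trans (sym (ℚ.*-distribʳ-+ p ½ ½)) (ℚ.*-identityˡ p)

  <-halves : p < ½ * ε → q < ½ * ε → p + q < ε
  <-halves {ε = ε} p< q< = subst (_ <_) (½*p+½*p≡p ε) (ℚ.+-mono-< p< q<)

  0<p*q : 0ℚ < p → 0ℚ < q → 0ℚ < p * q
  0<p*q {p} {q} 0<p 0<q =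
    ℚ.positive⁻¹ (p * q) {{ℚ.pos*pos⇒pos p {{positive 0<p}} q {{positive 0<q}}}}

  *-mono-≤-nonNeg : ∀ {p p′ q q′} → 0ℚ ≤ q → 0ℚ ≤ p′ → p ≤ p′ → q ≤ q′ → p * q ≤ p′ * q′
  *-mono-≤-nonNeg {p} {p′} {q} {q′} 0≤q 0≤p′ p≤p′ q≤q′ = ℚ.≤-trans
    (ℚ.*-monoʳ-≤-nonNeg q {{nonNegative 0≤q}} p≤p′)
    (ℚ.*-monoˡ-≤-nonNeg p′ {{nonNegative 0≤p′}} q≤q′)

  ∣p∣*∣q∣<½ε : ∀ {B} (0<B : 0ℚ < B) → ∣ p ∣ ≤ B →
               ∣ q ∣ < (1/ B) {{>-nonZero 0<B}} * (½ * ε) → ∣ p * q ∣ < ½ * ε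
  ∣p∣*∣q∣<½ε {p} {q} {ε} {B} 0<B p≤B q< = subst (_< ½ * ε) (sym (ℚ.∣p*q∣≡∣p∣*∣q∣ p q))
    (ℚ.≤-<-trans
      (ℚ.*-monoʳ-≤-nonNeg ∣ q ∣ {{nonNegative (ℚ.0≤∣p∣ q)}} p≤B)
      (subst (B * ∣ q ∣ <_) eq (ℚ.*-monoʳ-<-pos B {{positive 0<B}} q<)))
    where
    instance _ = >-nonZero 0<B
    eq : B * (1/ B * (½ * ε)) ≡ ½ * ε
    eq = trans (sym (ℚ.*-assoc B (1/ B) (½ * ε)))
               (trans (cong (_* (½ * ε)) (ℚ.*-inverseʳ B)) (ℚ.*-identityˡ (½ * ε)))

  0<1/p : (0<p : 0ℚ < p) → 0ℚ < (1/ p) {{>-nonZero 0<p}}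
  0<1/p {p} 0<p = ℚ.positive⁻¹ _ {{ℚ.1/pos⇒pos p {{positive 0<p}}}}

  1≤p*p : 1ℚ ≤ p → 1ℚ ≤ p * p
  1≤p*p {p} 1≤p = subst (_≤ p * p) (ℚ.*-identityˡ 1ℚ)
    (*-mono-≤-nonNeg (ℚ.nonNegative⁻¹ 1ℚ) (ℚ.≤-trans (ℚ.nonNegative⁻¹ 1ℚ) 1≤p) 1≤p 1≤p)

  -- The reciprocal, with value 0 at 0.
  recip : ℚ → ℚ
  recip p with p ℚ.≟ 0ℚ
  ... | yes _   = 0ℚ
  ... | no p≢0 = (1/ p) {{≢-nonZero p≢0}}

  p*recip[p]≡1 : 0ℚ < p → p * recip p ≡ 1ℚ
  p*recip[p]≡1 {p} 0<p with p ℚ.≟ 0ℚ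
  ... | yes p≡0 = contradiction (sym p≡0) (ℚ.<⇒≢ 0<p)
  ... | no p≢0  = ℚ.*-inverseʳ p {{≢-nonZero p≢0}}

  ∣recip-recip∣<ε : ∀ {δ} → 0ℚ < δ → δ ≤ p → δ ≤ q →
                    ∣ p - q ∣ < ε * (δ * δ) → ∣ recip p - recip q ∣ < ε
  ∣recip-recip∣<ε {p} {q} {ε} {δ} 0<δ δ≤p δ≤q close =
    ℚ.*-cancelʳ-<-nonNeg (p * q) {{nonNegative (ℚ.<⇒≤ 0<pq)}}
      (ℚ.≤-<-trans (ℚ.≤-reflexive eq) (ℚ.<-≤-trans close le))
    where
    0<p = ℚ.<-≤-trans 0<δ δ≤p
    0<q = ℚ.<-≤-trans 0<δ δ≤q
    0<pq = 0<p*q 0<p 0<q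
    0<ε : 0ℚ < ε
    0<ε = ℚ.*-cancelʳ-<-nonNeg (δ * δ) {{nonNegative (ℚ.<⇒≤ (0<p*q 0<δ 0<δ))}}
      (subst (_< ε * (δ * δ)) (sym (ℚ.*-zeroˡ (δ * δ))) (ℚ.≤-<-trans (ℚ.0≤∣p∣ (p - q)) close))
    le : ε * (δ * δ) ≤ ε * (p * q)
    le = ℚ.*-monoˡ-≤-nonNeg ε {{nonNegative (ℚ.<⇒≤ 0<ε)}}
      (*-mono-≤-nonNeg (ℚ.<⇒≤ 0<δ) (ℚ.<⇒≤ 0<p) δ≤p δ≤q)
    open +-*-Solver
    expand : ∀ p q a b → (a - b) * (p * q) ≡ (p * a) * q - (q * b) * p
    expand = solve 4 (λ p q a b → (a :- b) :* (p :* q) := (p :* a) :* q :- (q :* b) :* p) refl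
    eq : ∣ recip p - recip q ∣ * (p * q) ≡ ∣ p - q ∣
    eq = trans (cong (∣ recip p - recip q ∣ *_) (sym (ℚ.0≤p⇒∣p∣≡p (ℚ.<⇒≤ 0<pq))))
      (trans (sym (ℚ.∣p*q∣≡∣p∣*∣q∣ (recip p - recip q) (p * q)))
      (trans (cong ∣_∣ (trans (expand p q (recip p) (recip q))
               (cong₂ _-_ (trans (cong (_* q) (p*recip[p]≡1 0<p)) (ℚ.*-identityˡ q))
                          (trans (cong (_* p) (p*recip[p]≡1 0<q)) (ℚ.*-identityˡ p)))))
      (∣p-q∣-sym q p)))

------------------------------------------------------------------------
-- Rational approximation of square roots

-- From ⌊√ n⌋ = r to ⌊√ (suc n)⌋.
isqrtStep : (r n : ℕ) → ℕ
isqrtStep r n with suc r ℕ.* suc r ℕ.≤? suc n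
... | yes _ = suc r
... | no  _ = r

isqrt : ℕ → ℕ
isqrt zero    = 0
isqrt (suc n) = isqrtStep (isqrt n) n

isqrtStep-lower : ∀ r n → r ℕ.* r ℕ.≤ n → isqrtStep r n ℕ.* isqrtStep r n ℕ.≤ suc n
isqrtStep-lower r n r²≤n with suc r ℕ.* suc r ℕ.≤? suc n
... | yes le = le
... | no  _  = ℕ.m≤n⇒m≤1+n r²≤n

isqrtStep-upper : ∀ r n → n ℕ.< suc r ℕ.* suc r →
                  suc n ℕ.< suc (isqrtStep r n) ℕ.* suc (isqrtStep r n)
isqrtStep-upper r n n<r² with suc r ℕ.* suc r ℕ.≤? suc n
... | yes _   = ℕ.≤-<-trans n<r²
  (ℕ.*-mono-< {suc r} {suc (suc r)} {suc r} {suc (suc r)} (ℕ.n<1+n (suc r)) (ℕ.n<1+n (suc r)))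
... | no  ¬le = ℕ.≰⇒> ¬le

isqrt-lower : ∀ n → isqrt n ℕ.* isqrt n ℕ.≤ n
isqrt-lower zero    = ℕ.z≤n
isqrt-lower (suc n) = isqrtStep-lower (isqrt n) n (isqrt-lower n)

isqrt-upper : ∀ n → n ℕ.< suc (isqrt n) ℕ.* suc (isqrt n)
isqrt-upper zero    = ℕ.s≤s ℕ.z≤n
isqrt-upper (suc n) = isqrtStep-upper (isqrt n) n (isqrt-upper n)

module SquareRoot where
  open import Data.Rational
  open RationalLemmas

  -- √ ∣ u / v ∣ = √ (∣ u ∣ v N²) / (v N) with N = suc n, rounded down to a
  -- multiple of 1 / (v N).
  sqrtApprox : ℕ → ℚ → ℚ
  sqrtApprox n q@(mkℚ _ _ _) =
    + isqrt (ℤ.∣ ↥ q ∣ ℕ.* ↧ₙ q ℕ.* (suc n ℕ.* suc n)) / (↧ₙ q ℕ.* suc n)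

  private
    scale : ∀ u v n → u ℕ.* v ℕ.* (n ℕ.* n) ℕ.* v ≡ u ℕ.* ((v ℕ.* n) ℕ.* (v ℕ.* n))
    scale = solve 3 (λ u v n → u :* v :* (n :* n) :* v := u :* ((v :* n) :* (v :* n))) refl
      where open ℕ.+-*-Solver

    /-toℚᵘ : ∀ p w-1 → toℚᵘ (+ p / suc w-1) ℚᵘ.≃ ℚᵘ.mkℚᵘ (+ p) w-1
    /-toℚᵘ p w-1 = ℚ.toℚᵘ-fromℚᵘ (ℚᵘ.mkℚᵘ (+ p) w-1)

    sq-toℚᵘ : ∀ p w-1 → toℚᵘ (+ p / suc w-1 * (+ p / suc w-1)) ℚᵘ.≃
                        ℚᵘ.mkℚᵘ (+ p) w-1 ℚᵘ.* ℚᵘ.mkℚᵘ (+ p) w-1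
    sq-toℚᵘ p w-1 = ℚᵘ.≃-trans (ℚ.toℚᵘ-homo-* (+ p / suc w-1) (+ p / suc w-1))
                               (ℚᵘ.*-cong (/-toℚᵘ p w-1) (/-toℚᵘ p w-1))

    cross-≤ : ∀ a b c d → a ℕ.* b ℕ.≤ c ℕ.* d → + a ℤ.* + b ℤ.≤ + c ℤ.* + d
    cross-≤ a b c d le = subst₂ ℤ._≤_ (ℤ.pos-* a b) (ℤ.pos-* c d) (ℤ.+≤+ le)

    cross-< : ∀ a b c d → a ℕ.* b ℕ.< c ℕ.* d → + a ℤ.* + b ℤ.< + c ℤ.* + d
    cross-< a b c d lt = subst₂ ℤ._<_ (ℤ.pos-* a b) (ℤ.pos-* c d) (ℤ.+<+ lt)

  0≤/ : ∀ p w .{{_ : ℕ.NonZero w}} → 0ℚ ≤ + p / w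
  0≤/ p w = ℚ.nonNegative⁻¹ (+ p / w) {{ℚ.normalize-nonNeg p w}}

  0≤sqrtApprox : ∀ n q → 0ℚ ≤ sqrtApprox n q
  0≤sqrtApprox n q@(mkℚ u d-1 _) =
    0≤/ (isqrt (ℤ.∣ u ∣ ℕ.* suc d-1 ℕ.* (suc n ℕ.* suc n))) (suc d-1 ℕ.* suc n)

  sqrtApprox-lower : ∀ n q → sqrtApprox n q * sqrtApprox n q ≤ ∣ q ∣
  sqrtApprox-lower n q@(mkℚ u d-1 _) = ℚ.toℚᵘ-cancel-≤
    (ℚᵘ.≤-respˡ-≃ (ℚᵘ.≃-sym (sq-toℚᵘ p (n ℕ.+ d-1 ℕ.* suc n)))
      (ℚᵘ.*≤* (subst (λ i → i ℤ.* + v ℤ.≤ + ℤ.∣ u ∣ ℤ.* + (w ℕ.* w)) (ℤ.pos-* p p)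
        (cross-≤ (p ℕ.* p) v ℤ.∣ u ∣ (w ℕ.* w)
          (subst (p ℕ.* p ℕ.* v ℕ.≤_) (scale ℤ.∣ u ∣ v (suc n))
            (ℕ.*-monoˡ-≤ v (isqrt-lower K)))))))
    where
    v = suc d-1
    w = v ℕ.* suc n
    K = ℤ.∣ u ∣ ℕ.* v ℕ.* (suc n ℕ.* suc n)
    p = isqrt K

  sqrtApprox-upper : ∀ n q → let t = sqrtApprox n q + + 1 / suc n in ∣ q ∣ < t * t
  sqrtApprox-upper n q@(mkℚ u d-1 _) = ℚ.<-≤-trans below
    (*-mono-≤-nonNeg 0≤t (ℚ.≤-trans 0≤t t≤) t≤ t≤)
    where
    v = suc d-1
    w-1 = n ℕ.+ d-1 ℕ.* suc n
    w = v ℕ.* suc n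
    K = ℤ.∣ u ∣ ℕ.* v ℕ.* (suc n ℕ.* suc n)
    p = isqrt K
    t = + suc p / w
    0≤t : 0ℚ ≤ t
    0≤t = 0≤/ (suc p) w
    below : ∣ q ∣ < t * t
    below = ℚ.toℚᵘ-cancel-<
      (ℚᵘ.<-respʳ-≃ (ℚᵘ.≃-sym (sq-toℚᵘ (suc p) w-1))
        (ℚᵘ.*<* (subst (λ i → + ℤ.∣ u ∣ ℤ.* + (w ℕ.* w) ℤ.< i ℤ.* + v) (ℤ.pos-* (suc p) (suc p))
          (cross-< ℤ.∣ u ∣ (w ℕ.* w) (suc p ℕ.* suc p) v
            (subst (ℕ._< suc p ℕ.* suc p ℕ.* v) (scale ℤ.∣ u ∣ v (suc n))
              (ℕ.*-monoˡ-< v (isqrt-upper K)))))))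
    t≤ : t ≤ sqrtApprox n q + + 1 / suc n
    t≤ = ℚ.toℚᵘ-cancel-≤
      (ℚᵘ.≤-respˡ-≃ (ℚᵘ.≃-sym (/-toℚᵘ (suc p) w-1))
        (ℚᵘ.≤-respʳ-≃ (ℚᵘ.≃-sym (ℚᵘ.≃-trans (ℚ.toℚᵘ-homo-+ (+ p / w) (+ 1 / suc n))
                                            (ℚᵘ.+-cong (/-toℚᵘ p w-1) (/-toℚᵘ 1 n))))
          (ℚᵘ.*≤* (subst (λ i → + suc p ℤ.* + (w ℕ.* suc n) ℤ.≤ i ℤ.* + w) eq
            (cross-≤ (suc p) (w ℕ.* suc n) (p ℕ.* suc n ℕ.+ 1 ℕ.* w) w le)))))
      where
      eq : + (p ℕ.* suc n ℕ.+ 1 ℕ.* w) ≡ + p ℤ.* + suc n ℤ.+ + 1 ℤ.* + w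
      eq = cong₂ ℤ._+_ (ℤ.pos-* p (suc n)) (ℤ.pos-* 1 w)
      regroup : ∀ p w n → (p ℕ.* n ℕ.+ n) ℕ.* w ≡ (w ℕ.* n) ℕ.+ p ℕ.* (w ℕ.* n)
      regroup = solve 3 (λ p w n → (p :* n :+ n) :* w := (w :* n) :+ p :* (w :* n)) refl
        where open ℕ.+-*-Solver
      le : suc p ℕ.* (w ℕ.* suc n) ℕ.≤ (p ℕ.* suc n ℕ.+ 1 ℕ.* w) ℕ.* w
      le = subst (ℕ._≤ (p ℕ.* suc n ℕ.+ 1 ℕ.* w) ℕ.* w) (regroup p w (suc n))
        (ℕ.*-monoˡ-≤ w (ℕ.+-monoʳ-≤ (p ℕ.* suc n)
          (subst (suc n ℕ.≤_) (sym (ℕ.*-identityˡ w)) (ℕ.m≤n*m (suc n) v))))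

  archimedean : ∀ {ε} → 0ℚ < ε → ∃[ N ] ∀ n → N ℕ.≤ n → + 1 / suc n ≤ ε
  archimedean {mkℚ (+ zero) d c} (*<* (ℤ.+<+ ()))
  archimedean {mkℚ (+ suc m) d-1 c} _ = suc d-1 , λ n N≤n → ℚ.toℚᵘ-cancel-≤
    (ℚᵘ.≤-respˡ-≃ (ℚᵘ.≃-sym (/-toℚᵘ 1 n))
      (ℚᵘ.*≤* (cross-≤ 1 (suc d-1) (suc m) (suc n)
        (subst (ℕ._≤ suc m ℕ.* suc n) (sym (ℕ.*-identityˡ (suc d-1)))
          (ℕ.≤-trans N≤n (ℕ.≤-trans (ℕ.n≤1+n n) (ℕ.m≤n*m (suc n) (suc m))))))))
  archimedean {mkℚ ℤ.-[1+ _ ] d c} (*<* ())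

  ½≤sqrtApprox : ∀ n q → 1ℚ ≤ ∣ q ∣ → + 1 / suc n ≤ ½ → ½ ≤ sqrtApprox n q
  ½≤sqrtApprox n q 1≤∣q∣ 1/n≤½ = ℚ.≮⇒≥ λ s<½ →
    ℚ.<-irrefl refl (ℚ.<-≤-trans (sqrtApprox-upper n q) (ℚ.≤-trans (t*t≤1 s<½) 1≤∣q∣))
    where
    t = sqrtApprox n q + + 1 / suc n
    t*t≤1 : sqrtApprox n q < ½ → t * t ≤ 1ℚ
    t*t≤1 s<½ = subst (t * t ≤_) (ℚ.*-identityˡ 1ℚ)
      (*-mono-≤-nonNeg (ℚ.+-mono-≤ (0≤sqrtApprox n q) (0≤/ 1 (suc n))) (ℚ.nonNegative⁻¹ 1ℚ) t≤1 t≤1)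
      where
      t≤1 : t ≤ 1ℚ
      t≤1 = ℚ.+-mono-≤ (ℚ.<⇒≤ s<½) 1/n≤½

  private
    sqrtApprox-<+ : ∀ {ε} → 0ℚ < ε → ∀ m n p q → + 1 / suc n ≤ ½ * ε →
                    ∣ p - q ∣ < (½ * ε) * (½ * ε) → sqrtApprox m p < sqrtApprox n q + ε
    sqrtApprox-<+ {ε} 0<ε m n p q 1/n≤ close with sqrtApprox m p <? sqrtApprox n q + ε
    ... | yes lt = lt
    ... | no ≮ = contradiction (ℚ.<-≤-trans ∣p∣< ≤∣p∣) (ℚ.<-irrefl refl)
      where
      e = ½ * ε
      s = sqrtApprox n q
      r = sqrtApprox m p
      0≤e = ℚ.<⇒≤ (0<½*p 0<ε)
      0≤s = 0≤sqrtApprox n q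
      0≤s+e : 0ℚ ≤ s + e
      0≤s+e = ℚ.+-mono-≤ 0≤s 0≤e
      0≤1/n : 0ℚ ≤ + 1 / suc n
      0≤1/n = 0≤/ 1 (suc n)
      ∣q∣< : ∣ q ∣ < (s + e) * (s + e)
      ∣q∣< = ℚ.<-≤-trans (sqrtApprox-upper n q)
        (*-mono-≤-nonNeg (ℚ.+-mono-≤ 0≤s 0≤1/n) 0≤s+e (ℚ.+-monoʳ-≤ s 1/n≤) (ℚ.+-monoʳ-≤ s 1/n≤))
      ∣p∣< : ∣ p ∣ < (s + e) * (s + e) + e * e
      ∣p∣< = ℚ.≤-<-trans (∣p∣≤∣q∣+∣p-q∣ p q) (ℚ.+-mono-< ∣q∣< close)
      r≥ : s + e + e ≤ r
      r≥ = subst (_≤ r) (trans (cong (λ x → s + x) (sym (½*p+½*p≡p ε))) (sym (ℚ.+-assoc s e e)))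
                 (ℚ.≮⇒≥ ≮)
      0≤s+e+e = ℚ.+-mono-≤ 0≤s+e 0≤e
      expand : ∀ t e → (t + e) * (t + e) ≡ t * t + e * e + (t * e + t * e)
      expand = solve 2 (λ t e → (t :+ e) :* (t :+ e) := t :* t :+ e :* e :+ (t :* e :+ t :* e)) refl
        where open +-*-Solver
      0≤te : 0ℚ ≤ (s + e) * e
      0≤te = subst (_≤ (s + e) * e) (ℚ.*-zeroˡ 0ℚ) (*-mono-≤-nonNeg ℚ.≤-refl 0≤s+e 0≤s+e 0≤e)
      ≤∣p∣ : (s + e) * (s + e) + e * e ≤ ∣ p ∣
      ≤∣p∣ = ℚ.≤-trans
        (subst₂ _≤_ (ℚ.+-identityʳ _) (sym (expand (s + e) e))
          (ℚ.+-monoʳ-≤ ((s + e) * (s + e) + e * e) (ℚ.+-mono-≤ 0≤te 0≤te)))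
        (ℚ.≤-trans (*-mono-≤-nonNeg 0≤s+e+e (ℚ.≤-trans 0≤s+e+e r≥) r≥ r≥) (sqrtApprox-lower m p))

  sqrtApprox-close : ∀ {ε} → 0ℚ < ε → ∀ m n p q → + 1 / suc m ≤ ½ * ε → + 1 / suc n ≤ ½ * ε →
                     ∣ p - q ∣ < (½ * ε) * (½ * ε) → ∣ sqrtApprox m p - sqrtApprox n q ∣ < ε
  sqrtApprox-close {ε} 0<ε m n p q 1/m≤ 1/n≤ close = ∣p-q∣<r _ _ ε
    (sqrtApprox-<+ 0<ε m n p q 1/n≤ close)
    (sqrtApprox-<+ 0<ε n m q p 1/m≤ (subst (_< _) (∣p-q∣-sym p q) close))

------------------------------------------------------------------------
-- The real numbers, as Cauchy sequences of rationals

-- P holds at all sufficiently large indices.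
Eventually : Pred ℕ 0ℓ → Set
Eventually P = ∃[ N ] ∀ n → N ℕ.≤ n → P n

Eventually₂ : (ℕ → ℕ → Set) → Set
Eventually₂ P = ∃[ N ] ∀ m n → N ℕ.≤ m → N ℕ.≤ n → P m n

IsCauchy : (ℕ → ℚ) → Set
IsCauchy x = ∀ ε → 0ℚ ℚ.< ε → Eventually₂ λ m n → ℚ.∣ x m ℚ.- x n ∣ ℚ.< ε

-- Moduli of convergence are abstract: unfolding them makes comparing reals
-- during type checking infeasible.
module CauchyLemmas where
  open import Data.Rational
  open RationalLemmas
  open SquareRoot

  combine : ∀ {P Q R : ℕ → ℕ → Set} → Eventually₂ P → Eventually₂ Q →
            (∀ m n → P m n → Q m n → R m n) → Eventually₂ R
  combine (N₁ , h₁) (N₂ , h₂) f = N₁ ℕ.⊔ N₂ , λ m n N≤m N≤n → f m n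
    (h₁ m n (ℕ.m⊔n≤o⇒m≤o N₁ N₂ N≤m) (ℕ.m⊔n≤o⇒m≤o N₁ N₂ N≤n))
    (h₂ m n (ℕ.m⊔n≤o⇒n≤o N₁ N₂ N≤m) (ℕ.m⊔n≤o⇒n≤o N₁ N₂ N≤n))

  both : ∀ {P : ℕ → Set} → Eventually P → Eventually₂ λ m n → P m × P n
  both (N , h) = N , λ m n N≤m N≤n → h m N≤m , h n N≤n

  abstract
    const-cauchy : ∀ q → IsCauchy λ _ → q
    const-cauchy q ε 0<ε = 0 , λ _ _ _ _ →
      subst (_< ε) (sym (cong ∣_∣ (ℚ.+-inverseʳ q))) 0<ε

  bounded : ∀ {z} → IsCauchy z → ∃[ B ] 0ℚ < B × Eventually λ n → ∣ z n ∣ ≤ B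
  bounded {z} cz = ∣ z N ∣ + 1ℚ , ℚ.+-mono-≤-< (ℚ.0≤∣p∣ (z N)) (ℚ.positive⁻¹ 1ℚ) , N , λ n N≤n →
    ℚ.≤-trans (∣p∣≤∣q∣+∣p-q∣ (z n) (z N))
              (ℚ.+-monoʳ-≤ ∣ z N ∣ (ℚ.<⇒≤ (proj₂ (cz 1ℚ (ℚ.positive⁻¹ 1ℚ)) n N N≤n ℕ.≤-refl)))
    where N = proj₁ (cz 1ℚ (ℚ.positive⁻¹ 1ℚ))

  module _ {x y : ℕ → ℚ} (cx : IsCauchy x) (cy : IsCauchy y) where

    private
      interchange : ∀ a a′ b b′ → (a - a′) + (b - b′) ≡ (a + b) - (a′ + b′)
      interchange = solve 4 (λ a a′ b b′ → (a :- a′) :+ (b :- b′) := (a :+ b) :- (a′ :+ b′)) refl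
        where open +-*-Solver

      interchange′ : ∀ a a′ b b′ → (a - a′) - (b - b′) ≡ (a - b) - (a′ - b′)
      interchange′ = solve 4 (λ a a′ b b′ → (a :- a′) :- (b :- b′) := (a :- b) :- (a′ :- b′)) refl
        where open +-*-Solver

      split : ∀ a a′ b b′ → a * (b - b′) + b′ * (a - a′) ≡ a * b - a′ * b′
      split = solve 4 (λ a a′ b b′ → a :* (b :- b′) :+ b′ :* (a :- a′) := a :* b :- a′ :* b′) refl
        where open +-*-Solver

    abstract
      +-cauchy : IsCauchy λ n → x n + y n
      +-cauchy ε 0<ε = combine (cx (½ * ε) (0<½*p 0<ε)) (cy (½ * ε) (0<½*p 0<ε)) λ m n hx hy →
        subst (λ z → ∣ z ∣ < ε) (interchange (x m) (x n) (y m) (y n))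
          (ℚ.≤-<-trans (ℚ.∣p+q∣≤∣p∣+∣q∣ (x m - x n) (y m - y n)) (<-halves {ε = ε} hx hy))

      minus-cauchy : IsCauchy λ n → x n - y n
      minus-cauchy ε 0<ε = combine (cx (½ * ε) (0<½*p 0<ε)) (cy (½ * ε) (0<½*p 0<ε)) λ m n hx hy →
        subst (λ z → ∣ z ∣ < ε) (interchange′ (x m) (x n) (y m) (y n))
          (ℚ.≤-<-trans (ℚ.∣p-q∣≤∣p∣+∣q∣ (x m - x n) (y m - y n)) (<-halves {ε = ε} hx hy))

    private
      *-cauchy′ : (∃[ B ] 0ℚ < B × Eventually λ n → ∣ x n ∣ ≤ B) →
                  (∃[ C ] 0ℚ < C × Eventually λ n → ∣ y n ∣ ≤ C) →
                  IsCauchy λ n → x n * y n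
      *-cauchy′ (B , 0<B , hB) (C , 0<C , hC) ε 0<ε =
        combine (combine (both hB) (both hC) λ _ _ → _,_)
          (combine (cx (1/C * (½ * ε)) (0<p*q (0<1/p 0<C) (0<½*p 0<ε)))
                   (cy (1/B * (½ * ε)) (0<p*q (0<1/p 0<B) (0<½*p 0<ε))) λ _ _ → _,_)
          λ where
            m n ((xm≤B , _) , (_ , yn≤C)) (hx , hy) →
              subst (λ z → ∣ z ∣ < ε) (split (x m) (x n) (y m) (y n))
                (ℚ.≤-<-trans (ℚ.∣p+q∣≤∣p∣+∣q∣ (x m * (y m - y n)) (y n * (x m - x n)))
                  (<-halves {ε = ε} (∣p∣*∣q∣<½ε {ε = ε} 0<B xm≤B hy) (∣p∣*∣q∣<½ε {ε = ε} 0<C yn≤C hx)))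
        where
        1/B = (1/ B) {{>-nonZero 0<B}}
        1/C = (1/ C) {{>-nonZero 0<C}}

    abstract
      *-cauchy : IsCauchy λ n → x n * y n
      *-cauchy = *-cauchy′ (bounded cx) (bounded cy)

  abstract
    recip-cauchy : ∀ {x} → IsCauchy x →
                   (∃[ δ ] 0ℚ < δ × Eventually λ n → 0ℚ + δ ≤ x n) → IsCauchy (recip ∘ x)
    recip-cauchy {x} cx (δ , 0<δ , hδ) ε 0<ε =
      combine (both hδ) (cx (ε * (δ * δ)) (0<p*q 0<ε (0<p*q 0<δ 0<δ)))
        λ m n (δ≤xm , δ≤xn) close → ∣recip-recip∣<ε 0<δ (0+δ≤ δ≤xm) (0+δ≤ δ≤xn) close
      where
      0+δ≤ : ∀ {p} → 0ℚ + δ ≤ p → δ ≤ p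
      0+δ≤ {p} = subst (_≤ p) (ℚ.+-identityˡ δ)

    sqrt-cauchy : ∀ {x} → IsCauchy x → IsCauchy λ n → sqrtApprox n (x n)
    sqrt-cauchy {x} cx ε 0<ε =
      combine (both (archimedean (0<½*p 0<ε)))
              (cx (½ * ε * (½ * ε)) (0<p*q (0<½*p 0<ε) (0<½*p 0<ε)))
        λ m n (1/m≤ , 1/n≤) close → sqrtApprox-close 0<ε m n (x m) (x n) 1/m≤ 1/n≤ close

record ℝ : Set where
  constructor mkℝ
  field
    seq      : ℕ → ℚ
    isCauchy : IsCauchy seq

open ℝ public

infix 4 _≃_ _≤_ _<_

_≃_ : ℝ → ℝ → Set
x ≃ y = ∀ ε → 0ℚ ℚ.< ε → Eventually λ n → ℚ.∣ seq x n ℚ.- seq y n ∣ ℚ.< ε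

_≤_ : ℝ → ℝ → Set
x ≤ y = ∀ ε → 0ℚ ℚ.< ε → Eventually λ n → seq x n ℚ.≤ seq y n ℚ.+ ε

_<_ : ℝ → ℝ → Set
x < y = ∃[ ε ] 0ℚ ℚ.< ε × Eventually λ n → seq x n ℚ.+ ε ℚ.≤ seq y n

open CauchyLemmas

infixl 7 _*_
infixl 6 _+_ _-_
infix  9 √_

fromℚ : ℚ → ℝ
fromℚ q = mkℝ (λ _ → q) (const-cauchy q)

0ℝ 1ℝ : ℝ
0ℝ = fromℚ 0ℚ
1ℝ = fromℚ 1ℚ

_+_ _-_ _*_ : ℝ → ℝ → ℝ
x + y = mkℝ (λ n → seq x n ℚ.+ seq y n) (+-cauchy {seq x} {seq y} (isCauchy x) (isCauchy y))
x - y = mkℝ (λ n → seq x n ℚ.- seq y n) (minus-cauchy {seq x} {seq y} (isCauchy x) (isCauchy y))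
x * y = mkℝ (λ n → seq x n ℚ.* seq y n) (*-cauchy {seq x} {seq y} (isCauchy x) (isCauchy y))

reciprocal : (x : ℝ) → 0ℝ < x → ℝ
reciprocal x 0<x = mkℝ (RationalLemmas.recip ∘ seq x) (recip-cauchy {seq x} (isCauchy x) 0<x)

-- The square root of the absolute value, so that √ is total; it is used here
-- for nonnegative arguments only.
√_ : ℝ → ℝ
√ x = mkℝ (λ n → SquareRoot.sqrtApprox n (seq x n)) (sqrt-cauchy {seq x} (isCauchy x))

------------------------------------------------------------------------
-- Euclidean space

∑ : ∀ {m} → Vector ℝ m → ℝ
∑ = foldr _+_ 0ℝ

‖_‖ : ∀ {m} → Vector ℝ m → ℝ
‖ x ‖ = √ ∑ (λ i → x i * x i)

-- Open sets of ℝᵐ for the Euclidean metric.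
IsOpen : ∀ {m} → Pred (Vector ℝ m) 0ℓ → Set
IsOpen U = ∀ x → x ∈ U → ∃[ ε ] 0ℝ < ε × (∀ y → ‖ zipWith _-_ y x ‖ < ε → y ∈ U)

-- For D ⊆ S: every nonempty open set S ∩ U of the subspace S meets D.
_IsDenseIn_ : ∀ {m} → Pred (Vector ℝ m) 0ℓ → Pred (Vector ℝ m) 0ℓ → Set₁
D IsDenseIn S = ∀ U → IsOpen U → ∃[ x ] (x ∈ S × x ∈ U) → ∃[ y ] (y ∈ D × y ∈ U)

-- The part of the unit sphere of ℝᵐ with nonnegative coordinates; it has
-- dimension m - 1.
Sphere : ∀ m → Pred (Vector ℝ m) 0ℓ
Sphere m x = (∀ i → 0ℝ ≤ x i × x i ≤ 1ℝ) × ‖ x ‖ ≃ 1ℝ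

------------------------------------------------------------------------
-- Direction sets

ℕ⁺ : Set
ℕ⁺ = Σ[ n ∈ ℕ ] ℕ.NonZero n

fromℕ⁺ : ℕ⁺ → ℝ
fromℕ⁺ (n , _) = fromℚ (+ n ℚ./ 1)

module Positivity where
  open RationalLemmas
  open SquareRoot

  1≤n/1 : ∀ n → .{{ℕ.NonZero n}} → 1ℚ ℚ.≤ + n ℚ./ 1
  1≤n/1 (suc n) = ℚ.toℚᵘ-cancel-≤
    (ℚᵘ.≤-respʳ-≃ (ℚᵘ.≃-sym (ℚ.toℚᵘ-fromℚᵘ (ℚᵘ.mkℚᵘ (+ suc n) 0)))
      (ℚᵘ.*≤* (ℤ.+≤+ (ℕ.s≤s ℕ.z≤n))))

  0≤∑ : ∀ {m} (v : Vector ℝ m) n → (∀ i → 0ℚ ℚ.≤ seq (v i) n) → 0ℚ ℚ.≤ seq (∑ v) n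
  0≤∑ {zero}  v n 0≤v = ℚ.≤-refl
  0≤∑ {suc m} v n 0≤v = ℚ.+-mono-≤ (0≤v zero) (0≤∑ (v ∘ suc) n (0≤v ∘ suc))

  entry≤∑ : ∀ {m} (v : Vector ℝ m) n → (∀ i → 0ℚ ℚ.≤ seq (v i) n) →
            ∀ i → seq (v i) n ℚ.≤ seq (∑ v) n
  entry≤∑ {suc m} v n 0≤v zero = subst (ℚ._≤ seq (∑ v) n) (ℚ.+-identityʳ _)
    (ℚ.+-monoʳ-≤ (seq (v zero) n) (0≤∑ (v ∘ suc) n (0≤v ∘ suc)))
  entry≤∑ {suc m} v n 0≤v (suc i) = subst (ℚ._≤ seq (∑ v) n) (ℚ.+-identityˡ _)
    (ℚ.+-mono-≤ (0≤v zero) (entry≤∑ (v ∘ suc) n (0≤v ∘ suc) i))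

  abstract
    0<‖a‖ : ∀ {m} (a : Vector ℕ⁺ m) → Fin m → 0ℝ < ‖ map fromℕ⁺ a ‖
    0<‖a‖ {m} a i = ½ , 0<½ , N , λ n N≤n → subst (ℚ._≤ sqrtApprox n (q n)) (sym (ℚ.+-identityˡ ½))
      (½≤sqrtApprox n (q n) (1≤∣q∣ n) (h n N≤n))
      where
      0<½ : 0ℚ ℚ.< ½
      0<½ = ℚ.positive⁻¹ ½
      0≤1 : 0ℚ ℚ.≤ 1ℚ
      0≤1 = ℚ.nonNegative⁻¹ 1ℚ
      N : ℕ
      N = proj₁ (archimedean 0<½)
      h : ∀ n → N ℕ.≤ n → + 1 ℚ./ suc n ℚ.≤ ½
      h = proj₂ (archimedean 0<½)
      v : Vector ℝ m
      v j = fromℕ⁺ (a j) * fromℕ⁺ (a j)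
      q : ℕ → ℚ
      q = seq (∑ v)
      1≤v : ∀ n j → 1ℚ ℚ.≤ seq (v j) n
      1≤v n j = 1≤p*p (1≤n/1 (proj₁ (a j)) {{proj₂ (a j)}})
      1≤∣q∣ : ∀ n → 1ℚ ℚ.≤ ℚ.∣ q n ∣
      1≤∣q∣ n = ℚ.≤-trans
        (ℚ.≤-trans (1≤v n i) (entry≤∑ v n (λ j → ℚ.≤-trans 0≤1 (1≤v n j)) i))
        (p≤∣p∣ (q n))

open Positivity using (0<‖a‖)

-- a / ‖ a ‖
direction : ∀ {m} → Vector ℕ⁺ m → Vector ℝ m
direction a i = fromℕ⁺ (a i) * reciprocal ‖ map fromℕ⁺ a ‖ (0<‖a‖ a i)

D : ∀ m → Pred ℕ⁺ 0ℓ → Pred (Vector ℝ m) 0ℓ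
D m A x = ∃[ a ] ((∀ i → a i ∈ A) × (∀ i → x i ≃ direction {m} a i))

{-# OPTIONS --safe #-}

-- Density of D^m(A) means that every point of the sphere can be approximated
-- by directions of vectors with entries in A. For (a), approximate (0, x) and
-- drop the first entry: the rest is a multiple of an integer vector close to
-- the unit vector x, hence its direction is close to x.
--
-- For (b), with m = k - 1, let A contain for every positive integer vector v a
-- block of multiples c v₁, …, c vₘ, the factors c growing so fast that elements
-- of distinct blocks have ratio more than a constant C. Then D^m(A) contains
-- all rational directions. But the entries of a vector in A^k whose direction
-- is close to that of (1, 2, …, k) are strictly increasing and have bounded
-- ratios, so that all k of them lie in one block, which has only m elements.
module Submission where

open import Defs using (ℕ⁺; D; Sphere; _IsDenseIn_)
open import Level using (0ℓ)
open import Relation.Nullary using (¬_)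
open import Relation.Unary using (Pred)

-- Integers in widely separated blocks.

module Blocks where
  open import Data.Fin as Fin using (Fin; zero; suc)
  open import Data.Fin.Properties using (pigeonhole)
  open import Data.Nat
  open import Data.Nat.Properties
  open import Data.Product using (∃-syntax; _×_; _,_; proj₁; proj₂)
  open import Data.Sum using (inj₁; inj₂)
  open import Data.Vec.Functional using (Vector)
  open import Function using (_∘_)
  open import Relation.Binary.Definitions using (tri<; tri≈; tri>)
  open import Relation.Binary.PropositionalEquality
    using (_≡_; refl; sym; trans; cong; cong₂; subst₂)
  open import Relation.Nullary using (contradiction)
  open import Relation.Unary using (_∈_)

  -- 2ˣ (2y + 1)
  pair : ℕ → ℕ → ℕ
  pair zero    y = suc (2 * y)
  pair (suc x) y = 2 * pair x y

  pair-injective : ∀ x y x′ y′ → pair x y ≡ pair x′ y′ → x ≡ x′ × y ≡ y′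
  pair-injective zero    y zero     y′ eq = refl , *-cancelˡ-≡ y y′ 2 (suc-injective eq)
  pair-injective zero    y (suc x′) y′ eq = contradiction (sym eq) (even≢odd (pair x′ y′) y)
  pair-injective (suc x) y zero     y′ eq = contradiction eq (even≢odd (pair x y) y′)
  pair-injective (suc x) y (suc x′) y′ eq
    with x≡x′ , y≡y′ ← pair-injective x y x′ y′ (*-cancelˡ-≡ (pair x y) (pair x′ y′) 2 eq)
    = cong suc x≡x′ , y≡y′

  y<pair : ∀ x y → y < pair x y
  y<pair zero    y = s≤s (m≤n*m y 2)
  y<pair (suc x) y = <-≤-trans (y<pair x y) (m≤n*m (pair x y) 2)

  x<pair : ∀ x y → x < pair x y
  x<pair zero    y = s≤s z≤n
  x<pair (suc x) y = begin-strict
    suc x               ≤⟨ x<pair x y ⟩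
    pair x y            <⟨ m<m+n (pair x y) (≤-<-trans z≤n (y<pair x y)) ⟩
    pair x y + pair x y ≡⟨ cong (pair x y +_) (sym (+-identityʳ (pair x y))) ⟩
    2 * pair x y        ∎
    where open ≤-Reasoning

  -- Numbers the vectors so that their blocks can be laid out along the naturals. Besides
  -- injectivity, it matters that a code bounds the entries of its vector: the size of a block can
  -- then be estimated from its number alone.
  encode : ∀ {m} → Vector ℕ m → ℕ
  encode {zero}  v = 0
  encode {suc m} v = pair (v zero) (encode (v ∘ suc))

  encode-injective : ∀ {m} (u v : Vector ℕ m) → encode u ≡ encode v → ∀ i → u i ≡ v i
  encode-injective u v eq zero    = proj₁ (pair-injective (u zero) _ (v zero) _ eq)
  encode-injective u v eq (suc i) =
    encode-injective (u ∘ suc) (v ∘ suc) (proj₂ (pair-injective (u zero) _ (v zero) _ eq)) i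

  entry≤encode : ∀ {m} (v : Vector ℕ m) i → v i ≤ encode v
  entry≤encode v zero    = <⇒≤ (x<pair (v zero) (encode (v ∘ suc)))
  entry≤encode v (suc i) = ≤-trans (entry≤encode (v ∘ suc) i) (<⇒≤ (y<pair (v zero) (encode (v ∘ suc))))

  module _ (m C : ℕ) {{_ : NonZero C}} where

    -- A vector with code `e` has entries at most `e`, so its block reaches at most
    -- `base e * suc e`. The next factor is one more than `C` times this bound.
    base : ℕ → ℕ
    base zero    = 1
    base (suc e) = suc (C * (base e * suc e))

    base-nonZero : ∀ e → NonZero (base e)
    base-nonZero zero    = _
    base-nonZero (suc e) = _

    -- The block of v consists of the multiples of v + 1 by base (encode v);
    -- consecutive blocks are separated by a factor of more than C.
    blocks : Pred ℕ⁺ 0ℓ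
    blocks (n , _) = ∃[ v ] ∃[ i ] n ≡ base (encode {m} v) * suc (v i)

    blockPoint : Vector ℕ m → Vector ℕ⁺ m
    blockPoint v i = base (encode v) * suc (v i)
                   , m*n≢0 (base (encode v)) (suc (v i)) {{base-nonZero (encode v)}}

    blockPoint∈blocks : ∀ v i → blockPoint v i ∈ blocks
    blockPoint∈blocks v i = v , i , refl

    base-gap : ∀ {e e′} → e < e′ → C * (base e * suc e) < base e′
    base-gap {e} {suc e′} (s≤s e≤e′) with m≤n⇒m<n∨m≡n e≤e′
    ... | inj₂ refl = n<1+n _
    -- `base` increases, since `C` is nonzero, so a gap below `base e′` persists below the next
    -- factor.
    ... | inj₁ e<e′ = <-trans (base-gap e<e′)
      (s≤s (≤-trans (m≤m*n (base e′) (suc e′)) (m≤n*m (base e′ * suc e′) C)))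

    block-gap : ∀ (u v : Vector ℕ m) i j → encode u < encode v →
                C * (base (encode u) * suc (u i)) < base (encode v) * suc (v j)
    block-gap u v i j lt = ≤-<-trans
      (*-monoʳ-≤ C (*-monoʳ-≤ (base (encode u)) (s≤s (entry≤encode u i))))
      (<-≤-trans (base-gap lt) (m≤m*n (base (encode v)) (suc (v j))))

    -- Ratios below `C` force all `suc m` entries into one block. Its elements are indexed by
    -- `Fin m`, so two entries share an index and coincide, against strict growth.
    no-spread : (a : Vector ℕ⁺ (suc m)) → (∀ i → a i ∈ blocks) →
                (∀ i j → proj₁ (a i) < C * proj₁ (a j)) →
                ¬ (∀ i j → i Fin.< j → proj₁ (a i) < proj₁ (a j))
    no-spread a a∈A bounded increasing
      with i , j , i<j , idx≡ ← pigeonhole (n<1+n m) (λ i → proj₁ (proj₂ (a∈A i)))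
      = <-irrefl aᵢ≡aⱼ (increasing i j i<j)
      where
      v : ∀ i → Vector ℕ m
      v i = proj₁ (a∈A i)
      idx : ∀ i → Fin m
      idx i = proj₁ (proj₂ (a∈A i))
      a≡ : ∀ i → proj₁ (a i) ≡ base (encode (v i)) * suc (v i (idx i))
      a≡ i = proj₂ (proj₂ (a∈A i))
      not-before : ∀ i j → ¬ (encode (v i) < encode (v j))
      -- If `a i` came from an earlier block than `a j`, then `a j` would exceed `C` times `a i`.
      not-before i j lt = <-asym (bounded j i)
        (subst₂ (λ x y → C * x < y) (sym (a≡ i)) (sym (a≡ j)) (block-gap (v i) (v j) (idx i) (idx j) lt))
      same-code : ∀ i j → encode (v i) ≡ encode (v j)
      same-code i j with <-cmp (encode (v i)) (encode (v j))
      ... | tri< lt _ _ = contradiction lt (not-before i j)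
      ... | tri≈ _ eq _ = eq
      ... | tri> _ _ gt = contradiction gt (not-before j i)
      aᵢ≡aⱼ : proj₁ (a i) ≡ proj₁ (a j)
      aᵢ≡aⱼ = trans (a≡ i) (trans (cong₂ (λ e x → base e * suc x) (same-code i j)
        (trans (encode-injective (v i) (v j) (same-code i j) (idx i)) (cong (v j) idx≡))) (sym (a≡ j)))

module Approximation where
  open import Data.Fin as Fin using (Fin; zero; suc)
  import Data.Fin.Properties as Fin
  open import Data.Integer.Base as ℤ using (+_)
  import Data.Integer.Properties as ℤ
  open import Data.Nat as ℕ using (ℕ; zero; suc)
  import Data.Nat.Properties as ℕ
  open import Data.Product using (∃; ∃-syntax; Σ-syntax; _×_; _,_; proj₁; proj₂)
  open import Data.Rational
  import Data.Rational.Properties as ℚ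
  open import Data.Rational.Solver using (module +-*-Solver)
  import Data.Rational.Unnormalised as ℚᵘ
  import Data.Rational.Unnormalised.Properties as ℚᵘ
  open import Data.Sum using (inj₁; inj₂)
  open import Data.Vec.Functional using (Vector; _∷_; foldr; map; zipWith)
  open import Function using (_∘_)
  open import Relation.Binary.PropositionalEquality
    using (_≡_; refl; sym; trans; cong; cong₂; subst; subst₂)
  open import Relation.Nullary using (yes; no)
  open import Relation.Unary using (_∈_)
  import Defs as ℝ
  open ℝ using (ℝ; seq; isCauchy; ‖_‖; ∑; Eventually; IsOpen; direction; fromℕ⁺)
  open ℝ.RationalLemmas
  open ℝ.SquareRoot
  open Blocks

  -- Naturals as rationals, and estimates with absolute values.

  fromℕ : ℕ → ℚ
  fromℕ n = + n / 1

  private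
    toℚᵘ-fromℕ : ∀ n → toℚᵘ (fromℕ n) ℚᵘ.≃ ℚᵘ.mkℚᵘ (+ n) 0
    toℚᵘ-fromℕ n = ℚ.toℚᵘ-fromℚᵘ (ℚᵘ.mkℚᵘ (+ n) 0)

  fromℕ-suc : ∀ n → fromℕ (suc n) ≡ 1ℚ + fromℕ n
  fromℕ-suc n = ℚ.toℚᵘ-injective (ℚᵘ.≃-trans (toℚᵘ-fromℕ (suc n)) (ℚᵘ.≃-trans
    (ℚᵘ.*≡* (cong (ℤ._* (+ 1)) (cong (ℤ._+_ (+ 1)) (sym (ℤ.*-identityʳ (+ n))))))
    (ℚᵘ.≃-sym (ℚᵘ.≃-trans (ℚ.toℚᵘ-homo-+ 1ℚ (fromℕ n))
      (ℚᵘ.+-cong (ℚᵘ.≃-refl {ℚᵘ.mkℚᵘ (+ 1) 0}) (toℚᵘ-fromℕ n))))))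

  fromℕ-* : ∀ m n → fromℕ (m ℕ.* n) ≡ fromℕ m * fromℕ n
  fromℕ-* m n = ℚ.toℚᵘ-injective (ℚᵘ.≃-trans (toℚᵘ-fromℕ (m ℕ.* n)) (ℚᵘ.≃-trans
    (ℚᵘ.*≡* (cong (ℤ._* (+ 1)) (ℤ.pos-* m n)))
    (ℚᵘ.≃-sym (ℚᵘ.≃-trans (ℚ.toℚᵘ-homo-* (fromℕ m) (fromℕ n))
      (ℚᵘ.*-cong (toℚᵘ-fromℕ m) (toℚᵘ-fromℕ n))))))

  fromℕ-mono-≤ : ∀ m n → m ℕ.≤ n → fromℕ m ≤ fromℕ n
  fromℕ-mono-≤ m n m≤n = ℚ.toℚᵘ-cancel-≤
    (ℚᵘ.≤-respˡ-≃ (ℚᵘ.≃-sym (toℚᵘ-fromℕ m)) (ℚᵘ.≤-respʳ-≃ (ℚᵘ.≃-sym (toℚᵘ-fromℕ n))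
      (ℚᵘ.*≤* (ℤ.*-monoʳ-≤-nonNeg (+ 1) (ℤ.+≤+ m≤n)))))

  fromℕ-cancel-< : ∀ m n → fromℕ m < fromℕ n → m ℕ.< n
  fromℕ-cancel-< m n m<n = ℕ.≰⇒> λ n≤m → ℚ.<-irrefl refl (ℚ.<-≤-trans m<n (fromℕ-mono-≤ n m n≤m))

  0≤fromℕ : ∀ n → 0ℚ ≤ fromℕ n
  0≤fromℕ n = fromℕ-mono-≤ 0 n ℕ.z≤n

  fromℕ*1/ : ∀ n → fromℕ (suc n) * (+ 1 / suc n) ≡ 1ℚ
  fromℕ*1/ n = ℚ.toℚᵘ-injective (ℚᵘ.≃-trans (ℚ.toℚᵘ-homo-* (fromℕ (suc n)) (+ 1 / suc n))
    (ℚᵘ.≃-trans (ℚᵘ.*-cong (toℚᵘ-fromℕ (suc n)) (ℚ.toℚᵘ-fromℚᵘ (ℚᵘ.mkℚᵘ (+ 1) n)))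
      (ℚᵘ.*≡* (cong (+_) eq))))
    where
    eq : suc n ℕ.* 1 ℕ.* 1 ≡ 1 ℕ.* (1 ℕ.* suc n)
    eq = trans (ℕ.*-identityʳ _) (trans (ℕ.*-identityʳ _)
      (sym (trans (ℕ.*-identityˡ _) (ℕ.*-identityˡ _))))

  0<1/ : ∀ n → 0ℚ < + 1 / suc n
  0<1/ n = ℚ.positive⁻¹ (+ 1 / suc n) {{ℚ.normalize-pos 1 (suc n)}}

  0≤q-p : ∀ {p q} → p ≤ q → 0ℚ ≤ q - p
  0≤q-p {p} {q} p≤q = subst (_≤ q - p) (ℚ.+-inverseʳ p) (ℚ.+-monoˡ-≤ (- p) p≤q)

  0≤p+q : ∀ {p q} → 0ℚ ≤ p → 0ℚ ≤ q → 0ℚ ≤ p + q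
  0≤p+q = ℚ.+-mono-≤

  0≤p*q : ∀ {p q} → 0ℚ ≤ p → 0ℚ ≤ q → 0ℚ ≤ p * q
  0≤p*q {p} {q} 0≤p 0≤q = subst (_≤ p * q) (ℚ.*-zeroˡ 0ℚ) (*-mono-≤-nonNeg ℚ.≤-refl 0≤p 0≤p 0≤q)

  0<recip : ∀ {p} → 0ℚ < p → 0ℚ < recip p
  0<recip {p} 0<p = ℚ.*-cancelˡ-<-nonNeg p {{nonNegative (ℚ.<⇒≤ 0<p)}}
    (subst₂ _<_ (sym (ℚ.*-zeroʳ p)) (sym (p*recip[p]≡1 0<p)) (ℚ.positive⁻¹ 1ℚ))

  -- Reduces a linear inequality to a ring identity: the slack d is a
  -- combination of the slacks of the hypotheses.
  ≤-slack : ∀ {p q d} → 0ℚ ≤ d → p + d ≡ q → p ≤ q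
  ≤-slack {p} 0≤d eq = subst₂ _≤_ (ℚ.+-identityʳ p) eq (ℚ.+-monoʳ-≤ p 0≤d)

  ∣p∣≤ : ∀ {p r} → p ≤ r → - p ≤ r → ∣ p ∣ ≤ r
  ∣p∣≤ {p} {r} p≤r -p≤r with ℚ.∣p∣≡p∨∣p∣≡-p p
  ... | inj₁ eq = subst (_≤ r) (sym eq) p≤r
  ... | inj₂ eq = subst (_≤ r) (sym eq) -p≤r

  ∣p-q∣≤ : ∀ {p q r} → p ≤ q + r → q ≤ p + r → ∣ p - q ∣ ≤ r
  ∣p-q∣≤ {p} {q} {r} p≤ q≤ = ∣p∣≤ (≤-slack (0≤q-p p≤) (e₁ p q r)) (≤-slack (0≤q-p q≤) (e₂ p q r))
    where
    open +-*-Solver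
    e₁ : ∀ p q r → p - q + (q + r - p) ≡ r
    e₁ = solve 3 (λ p q r → p :- q :+ (q :+ r :- p) := r) refl
    e₂ : ∀ p q r → - (p - q) + (p + r - q) ≡ r
    e₂ = solve 3 (λ p q r → :- (p :- q) :+ (p :+ r :- q) := r) refl

  p≤q+r : ∀ {p q r} → ∣ p - q ∣ ≤ r → p ≤ q + r
  p≤q+r {p} {q} ≤r = ℚ.≤-trans (p≤q+∣p-q∣ p q) (ℚ.+-monoʳ-≤ q ≤r)

  q≤p+r : ∀ {p q r} → ∣ p - q ∣ ≤ r → q ≤ p + r
  q≤p+r {p} {q} ≤r = p≤q+r (subst (_≤ _) (∣p-q∣-sym p q) ≤r)

  ∣p-r∣≤ : ∀ {p q r a b} → ∣ p - q ∣ ≤ a → ∣ q - r ∣ ≤ b → ∣ p - r ∣ ≤ a + b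
  ∣p-r∣≤ {p} {q} {r} ≤a ≤b = subst (λ z → ∣ z ∣ ≤ _) (eq p q r)
    (ℚ.≤-trans (ℚ.∣p+q∣≤∣p∣+∣q∣ (p - q) (q - r)) (ℚ.+-mono-≤ ≤a ≤b))
    where
    open +-*-Solver
    eq : ∀ p q r → (p - q) + (q - r) ≡ p - r
    eq = solve 3 (λ p q r → (p :- q) :+ (q :- r) := p :- r) refl

  ∣p-p∣≡0 : ∀ p → ∣ p - p ∣ ≡ 0ℚ
  ∣p-p∣≡0 p = cong ∣_∣ (ℚ.+-inverseʳ p)

  ∣p*q∣≤ : ∀ {p q a b} → ∣ p ∣ ≤ a → ∣ q ∣ ≤ b → ∣ p * q ∣ ≤ a * b
  ∣p*q∣≤ {p} {q} ≤a ≤b = subst (_≤ _) (sym (ℚ.∣p*q∣≡∣p∣*∣q∣ p q))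
    (*-mono-≤-nonNeg (ℚ.0≤∣p∣ q) (ℚ.≤-trans (ℚ.0≤∣p∣ p) ≤a) ≤a ≤b)

  0≤p² : ∀ p → 0ℚ ≤ p * p
  0≤p² p with ℚ.∣p∣≡p∨∣p∣≡-p p
  ... | inj₁ eq = 0≤p*q 0≤p 0≤p
    where 0≤p = subst (0ℚ ≤_) eq (ℚ.0≤∣p∣ p)
  ... | inj₂ eq = subst (0ℚ ≤_) (e p) (0≤p*q 0≤-p 0≤-p)
    where
    0≤-p = subst (0ℚ ≤_) eq (ℚ.0≤∣p∣ p)
    open +-*-Solver
    e : ∀ p → - p * - p ≡ p * p
    e = solve 1 (λ p → :- p :* :- p := p :* p) refl

  ∣p∣²≡p² : ∀ p → ∣ p ∣ * ∣ p ∣ ≡ p * p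
  ∣p∣²≡p² p = trans (sym (ℚ.∣p*q∣≡∣p∣*∣q∣ p p)) (ℚ.0≤p⇒∣p∣≡p (0≤p² p))

  p²-cancel-≤ : ∀ {p q} → 0ℚ ≤ q → p * p ≤ q * q → p ≤ q
  p²-cancel-≤ {p} {q} 0≤q p²≤q² = ℚ.≮⇒≥ λ q<p → ℚ.<-irrefl refl (ℚ.≤-<-trans p²≤q²
    (ℚ.≤-<-trans (ℚ.*-monoˡ-≤-nonNeg q {{nonNegative 0≤q}} (ℚ.<⇒≤ q<p))
      (ℚ.*-monoˡ-<-pos p {{positive (ℚ.≤-<-trans 0≤q q<p)}} q<p)))

  -- An error budget: an estimate that multiplies the error `κ` by `k` still ends within `η`. The
  -- bound by 1 serves to absorb quadratic terms in `κ` into linear ones.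
  Fraction : ℕ → ℚ → Set
  Fraction k η = ∃[ κ ] 0ℚ < κ × fromℕ k * κ ≤ η × fromℕ k * κ ≤ 1ℚ

  -- The witness is min(η, 1) / (k + 1).
  shrink : ∀ k {η} → 0ℚ < η → Fraction (suc k) η
  shrink k {η} 0<η with ℚ.≤-total η 1ℚ
  ... | inj₁ η≤1 = η * (+ 1 / suc k) , 0<p*q 0<η (0<1/ k)
                 , ℚ.≤-reflexive (eq η) , subst (_≤ 1ℚ) (sym (eq η)) η≤1
    where
    open +-*-Solver
    swap : ∀ a b c → a * (b * c) ≡ b * (a * c)
    swap = solve 3 (λ a b c → a :* (b :* c) := b :* (a :* c)) refl
    eq : ∀ η → fromℕ (suc k) * (η * (+ 1 / suc k)) ≡ η
    eq η = trans (swap (fromℕ (suc k)) η (+ 1 / suc k)) (trans (cong (η *_) (fromℕ*1/ k)) (ℚ.*-identityʳ η))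
  ... | inj₂ 1≤η = + 1 / suc k , 0<1/ k
                 , subst (_≤ η) (sym (fromℕ*1/ k)) 1≤η , ℚ.≤-reflexive (fromℕ*1/ k)

  -- Finite sums and sums of squares.

  sum : ∀ {m} → Vector ℚ m → ℚ
  sum = foldr _+_ 0ℚ

  sumSq : ∀ {m} → Vector ℚ m → ℚ
  sumSq f = sum λ i → f i * f i

  sumSq-cong : ∀ {m} (f g : Vector ℚ m) → (∀ i → f i ≡ g i) → sumSq f ≡ sumSq g
  sumSq-cong {zero}  f g eq = refl
  sumSq-cong {suc m} f g eq =
    cong₂ _+_ (cong (λ z → z * z) (eq zero)) (sumSq-cong (f ∘ suc) (g ∘ suc) (eq ∘ suc))

  0≤sumSq : ∀ {m} (f : Vector ℚ m) → 0ℚ ≤ sumSq f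
  0≤sumSq {zero}  f = ℚ.≤-refl
  0≤sumSq {suc m} f = 0≤p+q (0≤p² (f zero)) (0≤sumSq (f ∘ suc))

  ∣sumSq∣ : ∀ {m} (f : Vector ℚ m) → ∣ sumSq f ∣ ≡ sumSq f
  ∣sumSq∣ f = ℚ.0≤p⇒∣p∣≡p (0≤sumSq f)

  fᵢ²≤sumSq : ∀ {m} (f : Vector ℚ m) i → f i * f i ≤ sumSq f
  fᵢ²≤sumSq f zero = subst (_≤ sumSq f) (ℚ.+-identityʳ _)
    (ℚ.+-monoʳ-≤ (f zero * f zero) (0≤sumSq (f ∘ suc)))
  fᵢ²≤sumSq f (suc i) = subst (_≤ sumSq f) (ℚ.+-identityˡ _)
    (ℚ.+-mono-≤ (0≤p² (f zero)) (fᵢ²≤sumSq (f ∘ suc) i))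

  sum-close : ∀ {m} (f g : Vector ℚ m) {c} → (∀ i → ∣ f i - g i ∣ ≤ c) → ∣ sum f - sum g ∣ ≤ fromℕ m * c
  sum-close {zero}  f g {c} close = ℚ.≤-reflexive (sym (ℚ.*-zeroˡ c))
  sum-close {suc m} f g {c} close = subst₂ _≤_
    (cong ∣_∣ (e₁ (f zero) (g zero) (sum (f ∘ suc)) (sum (g ∘ suc))))
    (trans (e₂ (fromℕ m) c) (cong (_* c) (sym (fromℕ-suc m))))
    (ℚ.≤-trans (ℚ.∣p+q∣≤∣p∣+∣q∣ (f zero - g zero) (sum (f ∘ suc) - sum (g ∘ suc)))
      (ℚ.+-mono-≤ (close zero) (sum-close (f ∘ suc) (g ∘ suc) (close ∘ suc))))
    where
    open +-*-Solver
    e₁ : ∀ a b c d → (a - b) + (c - d) ≡ (a + c) - (b + d)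
    e₁ = solve 4 (λ a b c d → (a :- b) :+ (c :- d) := (a :+ c) :- (b :+ d)) refl
    e₂ : ∀ a c → c + a * c ≡ (1ℚ + a) * c
    e₂ = solve 2 (λ a c → c :+ a :* c := (con 1ℚ :+ a) :* c) refl

  sumSq-*ʳ : ∀ {m} (f : Vector ℚ m) c → sumSq (λ i → f i * c) ≡ sumSq f * (c * c)
  sumSq-*ʳ {zero}  f c = sym (ℚ.*-zeroˡ (c * c))
  sumSq-*ʳ {suc m} f c = trans (cong (_+_ (f zero * c * (f zero * c))) (sumSq-*ʳ (f ∘ suc) c))
    (eq (f zero) c (sumSq (f ∘ suc)))
    where
    open +-*-Solver
    eq : ∀ a c s → a * c * (a * c) + s * (c * c) ≡ (a * a + s) * (c * c)
    eq = solve 3 (λ a c s → a :* c :* (a :* c) :+ s :* (c :* c) := (a :* a :+ s) :* (c :* c)) refl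

  -- The crude bound (mρ)², in place of mρ², is itself a square, so `sqrtApprox≤` turns it into the
  -- bound mρ on a norm.
  sumSq≤ : ∀ {m} (f : Vector ℚ m) {ρ} → 0ℚ ≤ ρ → (∀ i → ∣ f i ∣ ≤ ρ) →
           sumSq f ≤ (fromℕ m * ρ) * (fromℕ m * ρ)
  sumSq≤ {zero}  f {ρ} 0≤ρ f≤ρ = 0≤p² (fromℕ 0 * ρ)
  sumSq≤ {suc m} f {ρ} 0≤ρ f≤ρ = ℚ.≤-trans
    (ℚ.+-mono-≤ (subst (_≤ ρ * ρ) (∣p∣²≡p² (f zero))
                  (*-mono-≤-nonNeg (ℚ.0≤∣p∣ _) 0≤ρ (f≤ρ zero) (f≤ρ zero)))
                (sumSq≤ (f ∘ suc) 0≤ρ (f≤ρ ∘ suc)))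
    (≤-slack (0≤p+q 0≤ρmρ 0≤ρmρ)
      (trans (eq ρ (fromℕ m)) (cong (λ z → z * ρ * (z * ρ)) (sym (fromℕ-suc m)))))
    where
    0≤ρmρ : 0ℚ ≤ ρ * (fromℕ m * ρ)
    0≤ρmρ = 0≤p*q 0≤ρ (0≤p*q (0≤fromℕ m) 0≤ρ)
    open +-*-Solver
    eq : ∀ ρ m → (ρ * ρ + m * ρ * (m * ρ)) + (ρ * (m * ρ) + ρ * (m * ρ)) ≡ (1ℚ + m) * ρ * ((1ℚ + m) * ρ)
    eq = solve 2 (λ ρ m → (ρ :* ρ :+ m :* ρ :* (m :* ρ)) :+ (ρ :* (m :* ρ) :+ ρ :* (m :* ρ))
                            := (con 1ℚ :+ m) :* ρ :* ((con 1ℚ :+ m) :* ρ)) refl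

  -- Bounds on approximate square roots.

  sqrtApprox≤ : ∀ n {q B} → 0ℚ ≤ B → ∣ q ∣ ≤ B * B → sqrtApprox n q ≤ B
  sqrtApprox≤ n {q} 0≤B q≤B² = p²-cancel-≤ 0≤B (ℚ.≤-trans (sqrtApprox-lower n q) q≤B²)

  0≤sqrtApprox+ : ∀ n q → 0ℚ ≤ sqrtApprox n q + + 1 / suc n
  0≤sqrtApprox+ n q = 0≤p+q (0≤sqrtApprox n q) (ℚ.<⇒≤ (0<1/ n))

  ≤sqrtApprox+ : ∀ n {p q} → p * p ≤ ∣ q ∣ → p ≤ sqrtApprox n q + + 1 / suc n
  ≤sqrtApprox+ n {p} {q} p²≤q = p²-cancel-≤ (0≤sqrtApprox+ n q)
    (ℚ.≤-trans p²≤q (ℚ.<⇒≤ (sqrtApprox-upper n q)))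

  -- In t² - 1 = (t - 1)(t + 1) the second factor is at most κ + 2, hence at most 3.
  sq-near-1 : ∀ {t κ} → κ ≤ 1ℚ → ∣ t - 1ℚ ∣ ≤ κ → ∣ t * t - 1ℚ ∣ ≤ fromℕ 3 * κ
  sq-near-1 {t} {κ} κ≤1 close = subst₂ _≤_ (cong ∣_∣ (sym (e t))) (ℚ.*-comm κ (fromℕ 3))
    (∣p*q∣≤ {t - 1ℚ} {t - 1ℚ + fromℕ 2} close
      (ℚ.≤-trans (ℚ.∣p+q∣≤∣p∣+∣q∣ (t - 1ℚ) (fromℕ 2)) (ℚ.+-monoˡ-≤ (fromℕ 2) (ℚ.≤-trans close κ≤1))))
    where
    open +-*-Solver
    e : ∀ t → t * t - 1ℚ ≡ (t - 1ℚ) * (t - 1ℚ + fromℕ 2)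
    e = solve 1 (λ t → t :* t :- con 1ℚ := (t :- con 1ℚ) :* (t :- con 1ℚ :+ con (fromℕ 2))) refl

  -- Meant for a sum of squares, which is caught between the squares of its approximate root and of
  -- that root plus the rounding error, possibly after scaling.
  ∣-∣≤-sandwich : ∀ {a b p q e} → a ≤ p → p ≤ b → ∣ a - q ∣ ≤ e → ∣ b - q ∣ ≤ e → ∣ p - q ∣ ≤ e
  ∣-∣≤-sandwich {a} {b} {p} {q} {e} a≤p p≤b a≈q b≈q =
    ∣p-q∣≤ (ℚ.≤-trans p≤b (p≤q+r {b} {q} b≈q)) (ℚ.≤-trans (q≤p+r {a} {q} a≈q) (ℚ.+-monoˡ-≤ e a≤p))

  -- Density as rational approximation

  eventually-∩ : ∀ {P Q : Pred ℕ 0ℓ} → Eventually P → Eventually Q → Eventually λ n → P n × Q n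
  eventually-∩ (M , p) (N , q) = M ℕ.⊔ N , λ n le →
    p n (ℕ.m⊔n≤o⇒m≤o M N le) , q n (ℕ.m⊔n≤o⇒n≤o M N le)

  eventually-map : ∀ {P Q : Pred ℕ 0ℓ} → (∀ n → P n → Q n) → Eventually P → Eventually Q
  eventually-map f (N , p) = N , λ n le → f n (p n le)

  eventually-∀ : ∀ {m} {P : Fin m → Pred ℕ 0ℓ} → (∀ i → Eventually (P i)) → Eventually λ n → ∀ i → P i n
  eventually-∀ {zero}  p = 0 , λ _ _ ()
  eventually-∀ {suc m} p = eventually-map (λ where
      n (p₀ , ps) zero    → p₀
      n (p₀ , ps) (suc i) → ps i)
    (eventually-∩ (p zero) (eventually-∀ (p ∘ suc)))

  eventually⇒∃ : ∀ {P : Pred ℕ 0ℓ} → Eventually P → ∃ P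
  eventually⇒∃ (N , p) = N , p N ℕ.≤-refl

  -- Closeness is expressed on the late terms of the Cauchy sequences, which reduces all later
  -- estimates to rational arithmetic.
  Near : ∀ {m} → Vector ℝ m → ℚ → Pred (Vector ℝ m) 0ℓ
  Near x δ y = Eventually λ n → ∀ i → ∣ seq (y i) n - seq (x i) n ∣ ≤ δ

  seq-sumSq : ∀ {m} (v : Vector ℝ m) n →
              seq (∑ (λ i → v i ℝ.* v i)) n ≡ sumSq (λ i → seq (v i) n)
  seq-sumSq {zero}  v n = refl
  seq-sumSq {suc m} v n = cong (_+_ (seq (v zero) n * seq (v zero) n)) (seq-sumSq (v ∘ suc) n)

  seq-‖‖ : ∀ {m} (v : Vector ℝ m) n → seq ‖ v ‖ n ≡ sqrtApprox n (sumSq λ i → seq (v i) n)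
  seq-‖‖ v n = cong (sqrtApprox n) (seq-sumSq v n)

  -- The gap `ε` inside the strict inequality absorbs the rounding error `1 / suc n` of the
  -- approximate root.
  norm<⇒near : ∀ {m} (z y : Vector ℝ m) η → ‖ zipWith ℝ._-_ z y ‖ ℝ.< ℝ.fromℚ η → Near y η z
  norm<⇒near z y η (ε , 0<ε , lt) = eventually-map step (eventually-∩ lt (archimedean 0<ε))
    where
    step : ∀ n → seq ‖ zipWith ℝ._-_ z y ‖ n + ε ≤ η × + 1 / suc n ≤ ε →
           ∀ i → ∣ seq (z i) n - seq (y i) n ∣ ≤ η
    step n (σ+ε≤η , 1/n≤ε) i = begin
      ∣ d i ∣                              ≤⟨ ≤sqrtApprox+ n {∣ d i ∣} {sumSq d} le ⟩
      sqrtApprox n (sumSq d) + + 1 / suc n ≡⟨ cong (λ s → s + + 1 / suc n)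
                                                (sym (seq-‖‖ (zipWith ℝ._-_ z y) n)) ⟩
      σ + + 1 / suc n                      ≤⟨ ℚ.+-monoʳ-≤ σ 1/n≤ε ⟩
      σ + ε                                ≤⟨ σ+ε≤η ⟩
      η                                    ∎
      where
      open ℚ.≤-Reasoning
      σ : ℚ
      σ = seq ‖ zipWith ℝ._-_ z y ‖ n
      d : Vector ℚ _
      d j = seq (z j) n - seq (y j) n
      le : ∣ d i ∣ * ∣ d i ∣ ≤ ∣ sumSq d ∣
      le = subst₂ _≤_ (sym (∣p∣²≡p² (d i))) (sym (∣sumSq∣ d)) (fᵢ²≤sumSq d i)

  -- The radius `ρ` keeps the norm below half of the gap `e` between 0 and `ε`; the other half
  -- witnesses the strict inequality.
  near⇒norm< : ∀ {m} (y : Vector ℝ m) ε → ℝ.0ℝ ℝ.< ε →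
               ∃[ ρ ] 0ℚ < ρ × (∀ z → Near y ρ z → ‖ zipWith ℝ._-_ z y ‖ ℝ.< ε)
  near⇒norm< {m} y ε (e , 0<e , e≤ε) with shrink m (0<½*p 0<e)
  ... | ρ , 0<ρ , ρ≤½e , _ = ρ , 0<ρ , λ z near →
    ½ * e , 0<½*p 0<e , eventually-map (step z) (eventually-∩ e≤ε near)
    where
    0≤ρ = ℚ.<⇒≤ 0<ρ
    0≤mρ : 0ℚ ≤ fromℕ m * ρ
    0≤mρ = 0≤p*q (0≤fromℕ m) 0≤ρ
    mρ≤½e : fromℕ m * ρ ≤ ½ * e
    mρ≤½e = ℚ.≤-trans (ℚ.*-monoʳ-≤-nonNeg ρ {{nonNegative 0≤ρ}} (fromℕ-mono-≤ m (suc m) (ℕ.n≤1+n m))) ρ≤½e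
    step : ∀ z n → 0ℚ + e ≤ seq ε n × (∀ i → ∣ seq (z i) n - seq (y i) n ∣ ≤ ρ) →
           seq ‖ zipWith ℝ._-_ z y ‖ n + ½ * e ≤ seq ε n
    step z n (e≤ , close) = begin
      σ + ½ * e                           ≡⟨ cong (λ s → s + ½ * e) (seq-‖‖ (zipWith ℝ._-_ z y) n) ⟩
      sqrtApprox n (sumSq d) + ½ * e      ≤⟨ ℚ.+-monoˡ-≤ (½ * e)
                                               (ℚ.≤-trans (sqrtApprox≤ n {sumSq d} 0≤mρ le) mρ≤½e) ⟩
      ½ * e + ½ * e                       ≡⟨ ½*p+½*p≡p e ⟩
      e                                   ≡⟨ sym (ℚ.+-identityˡ e) ⟩
      0ℚ + e                              ≤⟨ e≤ ⟩
      seq ε n                             ∎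
      where
      open ℚ.≤-Reasoning
      σ : ℚ
      σ = seq ‖ zipWith ℝ._-_ z y ‖ n
      d : Vector ℚ m
      d j = seq (z j) n - seq (y j) n
      le : ∣ sumSq d ∣ ≤ (fromℕ m * ρ) * (fromℕ m * ρ)
      le = subst (_≤ _) (sym (∣sumSq∣ d)) (sumSq≤ d 0≤ρ close)

  -- The form of density in which both parts are proved: rational radii replace open sets, and
  -- integer vectors replace the points of `D m A`.
  Approximable : Pred ℕ⁺ 0ℓ → ℕ → Set
  Approximable A m = ∀ x → x ∈ Sphere m → ∀ δ → 0ℚ < δ →
    ∃[ a ] (∀ i → a i ∈ A) × Near x δ (direction {m} a)

  -- `Near x δ` alone is a closed condition; the margin `η` makes it open.
  ball : ∀ {m} → Vector ℝ m → ℚ → Pred (Vector ℝ m) 0ℓ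
  ball x δ y = ∃[ η ] 0ℚ < η × Near x (δ - η) y

  -- Half of the margin of `y` pays for the move to `z`, the other half is the margin of `z`.
  ball-isOpen : ∀ {m} (x : Vector ℝ m) δ → IsOpen (ball x δ)
  ball-isOpen x δ y (η , 0<η , near) = ℝ.fromℚ (½ * η) ,
    (½ * η , 0<½*p 0<η , 0 , λ _ _ → ℚ.≤-reflexive (ℚ.+-identityˡ _)) ,
    λ z lt → ½ * η , 0<½*p 0<η , eventually-map (step z) (eventually-∩ (norm<⇒near z y (½ * η) lt) near)
    where
    eq : ½ * η + (δ - η) ≡ δ - ½ * η
    eq = trans (cong (λ z → ½ * η + (δ - z)) (sym (½*p+½*p≡p η)))
      (solve 2 (λ h δ → h :+ (δ :- (h :+ h)) := δ :- h) refl (½ * η) δ)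
      where open +-*-Solver
    step : ∀ z n → (∀ i → ∣ seq (z i) n - seq (y i) n ∣ ≤ ½ * η) ×
                   (∀ i → ∣ seq (y i) n - seq (x i) n ∣ ≤ δ - η) →
           ∀ i → ∣ seq (z i) n - seq (x i) n ∣ ≤ δ - ½ * η
    step z n (z≈y , y≈x) i = subst (∣ seq (z i) n - seq (x i) n ∣ ≤_) eq
      (∣p-r∣≤ {seq (z i) n} {seq (y i) n} {seq (x i) n} (z≈y i) (y≈x i))

  direction∈D : ∀ A {m} (a : Vector ℕ⁺ m) → (∀ i → a i ∈ A) → D m A (direction a)
  direction∈D A a a∈A = a , a∈A , λ i ε 0<ε → 0 , λ n _ →
    subst (_< ε) (sym (∣p-p∣≡0 (seq (direction a i) n))) 0<ε

  -- The centre `x` lies in its ball with the full margin `δ`. A point of `D m A` in the ball agrees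
  -- with a direction only up to arbitrarily small errors of late terms, and its margin `η` covers
  -- such an error.
  dense⇒approximable : ∀ A {m} → D m A IsDenseIn Sphere m → Approximable A m
  dense⇒approximable A {m} dense x x∈S δ 0<δ = near-D
    (dense (ball x δ) (ball-isOpen x δ) (x , x∈S , δ , 0<δ , 0 , λ n _ i →
      ℚ.≤-reflexive (trans (∣p-p∣≡0 (seq (x i) n)) (sym (ℚ.+-inverseʳ δ)))))
    where
    open +-*-Solver
    eq : ∀ η → η + (δ - η) ≡ δ
    eq η = solve 2 (λ η δ → η :+ (δ :- η) := δ) refl η δ
    step : ∀ a y η n → (∀ i → ∣ seq (y i) n - seq (direction a i) n ∣ < η) ×
                       (∀ i → ∣ seq (y i) n - seq (x i) n ∣ ≤ δ - η) →
           ∀ i → ∣ seq (direction a i) n - seq (x i) n ∣ ≤ δ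
    step a y η n (y≈a , y≈x) i = subst (∣ seq (direction a i) n - seq (x i) n ∣ ≤_) (eq η)
      (∣p-r∣≤ {seq (direction a i) n} {seq (y i) n} {seq (x i) n}
        (subst (_≤ η) (∣p-q∣-sym (seq (y i) n) (seq (direction a i) n)) (ℚ.<⇒≤ (y≈a i))) (y≈x i))
    near-D : ∃[ y ] (y ∈ D m A × y ∈ ball x δ) → ∃[ a ] (∀ i → a i ∈ A) × Near x δ (direction {m} a)
    near-D (y , (a , a∈A , y≃a) , η , 0<η , near) = a , a∈A ,
      eventually-map (step a y η) (eventually-∩ (eventually-∀ λ i → y≃a i η 0<η) near)

  approximable⇒dense : ∀ A {m} → Approximable A m → D m A IsDenseIn Sphere m
  approximable⇒dense A {m} approx U U-open (x , x∈S , x∈U) = meet (U-open x x∈U)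
    where
    meet′ : ∀ ε → (∀ y → ‖ zipWith ℝ._-_ y x ‖ ℝ.< ε → y ∈ U) →
            (∃[ ρ ] 0ℚ < ρ × (∀ z → Near x ρ z → ‖ zipWith ℝ._-_ z x ‖ ℝ.< ε)) → ∃[ y ] (y ∈ D m A × y ∈ U)
    meet′ ε B⊆U (ρ , 0<ρ , near⇒<) =
      let a , a∈A , near = approx x x∈S ρ 0<ρ
      in direction a , direction∈D A a a∈A , B⊆U (direction a) (near⇒< (direction a) near)
    meet : ∃[ ε ] ℝ.0ℝ ℝ.< ε × (∀ y → ‖ zipWith ℝ._-_ y x ‖ ℝ.< ε → y ∈ U) → ∃[ y ] (y ∈ D m A × y ∈ U)
    meet (ε , 0<ε , B⊆U) = meet′ ε B⊆U (near⇒norm< x ε 0<ε)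

  -- Normalisation

  0≤1 : 0ℚ ≤ 1ℚ
  0≤1 = ℚ.nonNegative⁻¹ 1ℚ

  unitScale : ∀ {m} → ℕ → Vector ℚ m → ℚ
  unitScale n f = recip (sqrtApprox n (sumSq f))

  -- These hypotheses keep the approximate root at least ½, so that `recip` yields a true reciprocal
  -- and not its default 0, and the scale is at most 2.
  module UnitScale {m} (f : Vector ℚ m) (1≤S : 1ℚ ≤ sumSq f) (n : ℕ) (h≤½ : + 1 / suc n ≤ ½) where
    private
      S = sumSq f
      r = sqrtApprox n S
      s = unitScale n f
      h = + 1 / suc n
      ½≤r : ½ ≤ r
      ½≤r = ½≤sqrtApprox n S (subst (1ℚ ≤_) (sym (∣sumSq∣ f)) 1≤S) h≤½
      0≤r : 0ℚ ≤ r
      0≤r = 0≤sqrtApprox n S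
      rs≡1 : r * s ≡ 1ℚ
      rs≡1 = p*recip[p]≡1 (ℚ.<-≤-trans (ℚ.positive⁻¹ ½) ½≤r)

    0<unitScale : 0ℚ < s
    0<unitScale = ℚ.*-cancelˡ-<-nonNeg r {{nonNegative 0≤r}}
      (subst₂ _<_ (sym (ℚ.*-zeroʳ r)) (sym rs≡1) (ℚ.positive⁻¹ 1ℚ))

    private
      0≤s = ℚ.<⇒≤ 0<unitScale
      0≤s² = 0≤p*q 0≤s 0≤s
      s≤2 : s ≤ fromℕ 2
      s≤2 = ℚ.*-cancelˡ-≤-pos ½
        (subst (½ * s ≤_) rs≡1 (ℚ.*-monoʳ-≤-nonNeg s {{nonNegative 0≤s}} ½≤r))

    -- As 1 ≤ S, the root of S is at most S. The resulting bound is the same for all `n`.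
    recip[S]≤unitScale : recip S ≤ s
    recip[S]≤unitScale = ℚ.*-cancelˡ-≤-pos S {{positive 0<S}}
      (subst (_≤ S * s) (trans rs≡1 (sym (p*recip[p]≡1 0<S)))
        (ℚ.*-monoʳ-≤-nonNeg s {{nonNegative 0≤s}} (sqrtApprox≤ n (ℚ.<⇒≤ 0<S) ∣S∣≤S²)))
      where
      0<S : 0ℚ < S
      0<S = ℚ.<-≤-trans (ℚ.positive⁻¹ 1ℚ) 1≤S
      ∣S∣≤S² : ∣ S ∣ ≤ S * S
      ∣S∣≤S² = subst (_≤ S * S) (trans (ℚ.*-identityˡ S) (sym (∣sumSq∣ f)))
        (ℚ.*-monoʳ-≤-nonNeg S {{nonNegative (ℚ.<⇒≤ 0<S)}} 1≤S)

    -- The true root lies between r and r + h, and r s = 1, so the scaled sum of squares lies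
    -- between 1 and (1 + h s)². Here h s ≤ κ because s ≤ 2.
    unitScale-unit : ∀ {κ} → κ ≤ 1ℚ → h ≤ ½ * κ → ∣ sumSq (λ i → f i * s) - 1ℚ ∣ ≤ fromℕ 3 * κ
    unitScale-unit {κ} κ≤1 h≤½κ = subst (λ U → ∣ U - 1ℚ ∣ ≤ fromℕ 3 * κ) (sym (sumSq-*ʳ f s))
      (∣-∣≤-sandwich {1ℚ} {t * t} {S * (s * s)} {1ℚ} lower upper
        (subst (_≤ fromℕ 3 * κ) (sym (∣p-p∣≡0 1ℚ)) (0≤p*q (0≤fromℕ 3) 0≤κ))
        (sq-near-1 {t} κ≤1 (subst (λ z → ∣ z ∣ ≤ κ) (sym (e₁ (h * s)))
          (subst (_≤ κ) (sym (ℚ.0≤p⇒∣p∣≡p (0≤p*q 0≤h 0≤s))) hs≤κ))))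
      where
      t = 1ℚ + h * s
      0≤h = ℚ.<⇒≤ (0<1/ n)
      open +-*-Solver
      e₁ : ∀ z → 1ℚ + z - 1ℚ ≡ z
      e₁ = solve 1 (λ z → con 1ℚ :+ z :- con 1ℚ := z) refl
      e₂ : ∀ r s → (r * r) * (s * s) ≡ (r * s) * (r * s)
      e₂ = solve 2 (λ r s → (r :* r) :* (s :* s) := (r :* s) :* (r :* s)) refl
      e₃ : ∀ r h s → (r + h) * (r + h) * (s * s) ≡ (r * s + h * s) * (r * s + h * s)
      e₃ = solve 3 (λ r h s → (r :+ h) :* (r :+ h) :* (s :* s)
                                := (r :* s :+ h :* s) :* (r :* s :+ h :* s)) refl
      e₄ : ∀ κ → ½ * κ * fromℕ 2 ≡ κ
      e₄ = solve 1 (λ κ → con ½ :* κ :* con (fromℕ 2) := κ) refl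
      hs≤κ : h * s ≤ κ
      hs≤κ = subst (h * s ≤_) (e₄ κ) (*-mono-≤-nonNeg 0≤s (ℚ.≤-trans 0≤h h≤½κ) h≤½κ s≤2)
      0≤κ : 0ℚ ≤ κ
      0≤κ = ℚ.≤-trans (0≤p*q 0≤h 0≤s) hs≤κ
      lower : 1ℚ ≤ S * (s * s)
      lower = subst (_≤ S * (s * s)) (trans (e₂ r s) (cong (λ z → z * z) rs≡1))
        (ℚ.*-monoʳ-≤-nonNeg (s * s) {{nonNegative 0≤s²}}
          (subst (r * r ≤_) (∣sumSq∣ f) (sqrtApprox-lower n S)))
      upper : S * (s * s) ≤ t * t
      upper = subst (S * (s * s) ≤_) (trans (e₃ r h s) (cong (λ z → (z + h * s) * (z + h * s)) rs≡1))
        (ℚ.*-monoʳ-≤-nonNeg (s * s) {{nonNegative 0≤s²}}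
          (subst (_≤ (r + h) * (r + h)) (∣sumSq∣ f) (ℚ.<⇒≤ (sqrtApprox-upper n S))))

  -- Closeness of `y` to `x` makes the sum of squares Y of `y` close to 1. Since t² Y is close to 1
  -- as well, so is t, within 4κ. Then y t - x = y (t - 1) + (y - x) is at most 3 · 4κ + κ.
  rescale-close : ∀ {m} (x y : Vector ℚ m) {t δ κ} → 0ℚ ≤ t → 0ℚ ≤ δ →
                  fromℕ (suc (m ℕ.* 5)) * δ ≤ κ → fromℕ 13 * κ ≤ 1ℚ →
                  ∣ sumSq x - 1ℚ ∣ ≤ δ → ∣ sumSq (λ i → y i * t) - 1ℚ ∣ ≤ κ →
                  (∀ i → ∣ y i - x i ∣ ≤ δ) → ∀ i → ∣ y i * t - x i ∣ ≤ fromℕ 13 * κ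
  rescale-close {m} x y {t} {δ} {κ} 0≤t 0≤δ Mδ≤κ 13κ≤1 X≈1 U≈1 y≈x i =
    subst₂ _≤_ (cong ∣_∣ (sym (e₇ (y i) t (x i)))) (e₈ κ)
      (ℚ.≤-trans (ℚ.∣p+q∣≤∣p∣+∣q∣ (y i * (t - 1ℚ)) (y i - x i))
        (ℚ.+-mono-≤ (∣p*q∣≤ {y i} {t - 1ℚ} (∣y∣≤3 i) t≈1) (ℚ.≤-trans (y≈x i) δ≤κ)))
    where
    open +-*-Solver
    M = fromℕ m * fromℕ 5
    X = sumSq x
    Y = sumSq y
    eM : fromℕ (suc (m ℕ.* 5)) * δ ≡ (1ℚ + M) * δ
    eM = cong (_* δ) (trans (fromℕ-suc (m ℕ.* 5)) (cong (_+_ 1ℚ) (fromℕ-* m 5)))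
    e₁ : ∀ M δ → δ + M * δ ≡ (1ℚ + M) * δ
    e₁ = solve 2 (λ M δ → δ :+ M :* δ := (con 1ℚ :+ M) :* δ) refl
    δ≤κ : δ ≤ κ
    δ≤κ = ℚ.≤-trans (≤-slack (0≤p*q (0≤p*q (0≤fromℕ m) (0≤fromℕ 5)) 0≤δ) (trans (e₁ M δ) (sym eM))) Mδ≤κ
    0≤κ : 0ℚ ≤ κ
    0≤κ = ℚ.≤-trans 0≤δ δ≤κ
    κ≤½ : κ ≤ ½
    κ≤½ = ℚ.*-cancelˡ-≤-pos (fromℕ 13) (ℚ.≤-trans 13κ≤1
      (ℚ.*-monoˡ-≤-nonNeg (fromℕ 13) {1/ fromℕ 13} {½} (ℚ.≤ᵇ⇒≤ _)))
    δ≤1 : δ ≤ 1ℚ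
    δ≤1 = ℚ.≤-trans δ≤κ (ℚ.≤-trans κ≤½ (ℚ.≤ᵇ⇒≤ _))
    ∣x∣≤2 : ∀ i → ∣ x i ∣ ≤ fromℕ 2
    ∣x∣≤2 i = p²-cancel-≤ (0≤fromℕ 2) (begin
      ∣ x i ∣ * ∣ x i ∣   ≡⟨ ∣p∣²≡p² (x i) ⟩
      x i * x i           ≤⟨ fᵢ²≤sumSq x i ⟩
      X                   ≤⟨ p≤q+r {X} {1ℚ} X≈1 ⟩
      1ℚ + δ              ≤⟨ ℚ.+-monoʳ-≤ 1ℚ δ≤1 ⟩
      1ℚ + 1ℚ             ≤⟨ ℚ.≤ᵇ⇒≤ _ ⟩
      fromℕ 2 * fromℕ 2   ∎)
      where open ℚ.≤-Reasoning
    ∣y∣≤3 : ∀ i → ∣ y i ∣ ≤ fromℕ 3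
    ∣y∣≤3 i = ℚ.≤-trans (∣p∣≤∣q∣+∣p-q∣ (y i) (x i)) (ℚ.+-mono-≤ (∣x∣≤2 i) (ℚ.≤-trans (y≈x i) δ≤1))
    e₂ : ∀ y x → (y - x) * (y + x) ≡ y * y - x * x
    e₂ = solve 2 (λ y x → (y :- x) :* (y :+ x) := y :* y :- x :* x) refl
    -- The 5 is 3 + 2, from the bounds on y and x. Summing `m` such errors and adding the error δ of
    -- `X` gives the factor 5m + 1 of the hypothesis on δ.
    y²≈x² : ∀ i → ∣ y i * y i - x i * x i ∣ ≤ δ * fromℕ 5
    y²≈x² i = subst (λ z → ∣ z ∣ ≤ δ * fromℕ 5) (e₂ (y i) (x i))
      (∣p*q∣≤ {y i - x i} {y i + x i} (y≈x i)
        (ℚ.≤-trans (ℚ.∣p+q∣≤∣p∣+∣q∣ (y i) (x i)) (ℚ.+-mono-≤ (∣y∣≤3 i) (∣x∣≤2 i))))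
    e₃ : ∀ m δ → m * (δ * fromℕ 5) + δ ≡ (1ℚ + m * fromℕ 5) * δ
    e₃ = solve 2 (λ m δ → m :* (δ :* con (fromℕ 5)) :+ δ := (con 1ℚ :+ m :* con (fromℕ 5)) :* δ) refl
    Y≈1 : ∣ Y - 1ℚ ∣ ≤ κ
    Y≈1 = ℚ.≤-trans (subst (∣ Y - 1ℚ ∣ ≤_) (trans (e₃ (fromℕ m) δ) (sym eM))
      (∣p-r∣≤ {Y} {X} {1ℚ} (sum-close (λ i → y i * y i) (λ i → x i * x i) y²≈x²) X≈1)) Mδ≤κ
    ½≤Y : ½ ≤ Y
    ½≤Y = ≤-slack (0≤p+q (0≤q-p (q≤p+r {Y} {1ℚ} Y≈1)) (0≤q-p κ≤½)) (e₄ Y κ)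
      where
      e₄ : ∀ Y κ → ½ + ((Y + κ - 1ℚ) + (½ - κ)) ≡ Y
      e₄ = solve 2 (λ Y κ → con ½ :+ ((Y :+ κ :- con 1ℚ) :+ (con ½ :- κ)) := Y) refl
    ½≤[t+1]Y : ½ ≤ (t + 1ℚ) * Y
    ½≤[t+1]Y = subst (_≤ (t + 1ℚ) * Y) (ℚ.*-identityˡ ½)
      (*-mono-≤-nonNeg (ℚ.nonNegative⁻¹ ½) (0≤p+q 0≤t 0≤1)
        (ℚ.+-mono-≤ 0≤t (ℚ.≤-refl {1ℚ})) ½≤Y)
    e₅ : ∀ t Y → (t - 1ℚ) * ((t + 1ℚ) * Y) ≡ Y * (t * t) - Y
    e₅ = solve 2 (λ t Y → (t :- con 1ℚ) :* ((t :+ con 1ℚ) :* Y) := Y :* (t :* t) :- Y) refl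
    U≈Y : ∣ Y * (t * t) - Y ∣ ≤ κ + κ
    U≈Y = ∣p-r∣≤ {Y * (t * t)} {1ℚ} {Y}
      (subst (λ U → ∣ U - 1ℚ ∣ ≤ κ) (sumSq-*ʳ y t) U≈1) (subst (_≤ κ) (∣p-q∣-sym Y 1ℚ) Y≈1)
    e₆ : ∀ κ → κ + κ ≡ (fromℕ 4 * κ) * ½
    e₆ = solve 1 (λ κ → κ :+ κ := (con (fromℕ 4) :* κ) :* con ½) refl
    -- Divide |t - 1| (t + 1) Y ≤ 2κ by (t + 1) Y ≥ ½.
    t≈1 : ∣ t - 1ℚ ∣ ≤ fromℕ 4 * κ
    t≈1 = ℚ.*-cancelʳ-≤-pos ½ (begin
      ∣ t - 1ℚ ∣ * ½                    ≤⟨ ℚ.*-monoˡ-≤-nonNeg ∣ t - 1ℚ ∣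
                                             {{nonNegative (ℚ.0≤∣p∣ (t - 1ℚ))}} ½≤[t+1]Y ⟩
      ∣ t - 1ℚ ∣ * ((t + 1ℚ) * Y)       ≡⟨ cong (∣ t - 1ℚ ∣ *_) (sym (ℚ.0≤p⇒∣p∣≡p
                                             (ℚ.≤-trans (ℚ.nonNegative⁻¹ ½) ½≤[t+1]Y))) ⟩
      ∣ t - 1ℚ ∣ * ∣ (t + 1ℚ) * Y ∣     ≡⟨ sym (ℚ.∣p*q∣≡∣p∣*∣q∣ (t - 1ℚ) ((t + 1ℚ) * Y)) ⟩
      ∣ (t - 1ℚ) * ((t + 1ℚ) * Y) ∣     ≡⟨ cong ∣_∣ (e₅ t Y) ⟩
      ∣ Y * (t * t) - Y ∣               ≤⟨ U≈Y ⟩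
      κ + κ                             ≡⟨ e₆ κ ⟩
      (fromℕ 4 * κ) * ½                 ∎)
      where open ℚ.≤-Reasoning
    e₇ : ∀ y t x → y * t - x ≡ y * (t - 1ℚ) + (y - x)
    e₇ = solve 3 (λ y t x → y :* t :- x := y :* (t :- con 1ℚ) :+ (y :- x)) refl
    e₈ : ∀ κ → fromℕ 3 * (fromℕ 4 * κ) + κ ≡ fromℕ 13 * κ
    e₈ = solve 1 (λ κ → con (fromℕ 3) :* (con (fromℕ 4) :* κ) :+ κ := con (fromℕ 13) :* κ) refl

  -- Directions of positive integer vectors.

  val : ℕ⁺ → ℚ
  val a = fromℕ (proj₁ a)

  1≤val : ∀ a → 1ℚ ≤ val a
  1≤val (n , n≢0) = ℝ.Positivity.1≤n/1 n {{n≢0}}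

  scale : ∀ {m} → Vector ℕ⁺ m → ℕ → ℚ
  scale a n = unitScale n (val ∘ a)

  seq-direction : ∀ {m} (a : Vector ℕ⁺ m) i n → seq (direction a i) n ≡ val (a i) * scale a n
  seq-direction a i n = cong (λ r → val (a i) * recip r) (seq-‖‖ (map fromℕ⁺ a) n)

  1≤sumSq-val : ∀ {m} (a : Vector ℕ⁺ (suc m)) → 1ℚ ≤ sumSq (val ∘ a)
  1≤sumSq-val a = ℚ.≤-trans (1≤p*p (1≤val (a zero))) (fᵢ²≤sumSq (val ∘ a) zero)

  0<½ : 0ℚ < ½
  0<½ = ℚ.positive⁻¹ ½

  -- Provides a bound independent of the stage `n`, from which `¬approximable-blocks` chooses its
  -- tolerance.
  scale-bounded-below : ∀ {m} (a : Vector ℕ⁺ (suc m)) → ∃[ c ] 0ℚ < c × Eventually λ n → c ≤ scale a n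
  scale-bounded-below a = recip S , 0<recip (ℚ.<-≤-trans (ℚ.positive⁻¹ 1ℚ) (1≤sumSq-val a)) , eventually-map
    (λ n h≤½ → UnitScale.recip[S]≤unitScale (val ∘ a) (1≤sumSq-val a) n h≤½) (archimedean 0<½)
    where
    S = sumSq (val ∘ a)

  -- The vector is quantified inside, so one stage serves all integer vectors; their sums of squares
  -- are all at least 1.
  ScaleUnit : ℕ → ℚ → ℕ → Set
  ScaleUnit m η n = (a : Vector ℕ⁺ m) → 0ℚ < scale a n × ∣ sumSq (λ i → val (a i) * scale a n) - 1ℚ ∣ ≤ η

  scale-unit : ∀ {m η} → 0ℚ < η → Eventually (ScaleUnit (suc m) η)
  scale-unit {η = η} 0<η with shrink 2 0<η
  ... | κ , 0<κ , 3κ≤η , 3κ≤1 = eventually-map step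
      (eventually-∩ (archimedean 0<½) (archimedean (0<½*p 0<κ)))
    where
    open +-*-Solver
    e : ∀ κ → κ + (κ + κ) ≡ fromℕ 3 * κ
    e = solve 1 (λ κ → κ :+ (κ :+ κ) := con (fromℕ 3) :* κ) refl
    0≤κ = ℚ.<⇒≤ 0<κ
    κ≤1 : κ ≤ 1ℚ
    κ≤1 = ℚ.≤-trans (≤-slack (0≤p+q 0≤κ 0≤κ) (e κ)) 3κ≤1
    step : ∀ n → + 1 / suc n ≤ ½ × + 1 / suc n ≤ ½ * κ → ScaleUnit _ η n
    step n (h≤½ , h≤½κ) a = 0<unitScale , ℚ.≤-trans (unitScale-unit κ≤1 h≤½κ) 3κ≤η
      where open UnitScale (val ∘ a) (1≤sumSq-val a) n h≤½

  -- The norm condition controls the approximate root σ, while the sum of squares lies between σ²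
  -- and (σ + h)². Both σ and σ + h are within 2κ of 1, so their squares are within 6κ.
  sphere-unit : ∀ {m} {x : Vector ℝ m} → x ∈ Sphere m → ∀ {η} → 0ℚ < η →
                Eventually λ n → ∣ sumSq (λ i → seq (x i) n) - 1ℚ ∣ ≤ η
  sphere-unit {m} {x} (_ , ‖x‖≃1) {η} 0<η = build (shrink 5 0<η)
    where
    module _ (κ : ℚ) (0<κ : 0ℚ < κ) (6κ≤η : fromℕ 6 * κ ≤ η) (6κ≤1 : fromℕ 6 * κ ≤ 1ℚ) where
      open +-*-Solver
      e₁ : ∀ κ → (κ + κ) + (κ + κ + κ + κ) ≡ fromℕ 6 * κ
      e₁ = solve 1 (λ κ → (κ :+ κ) :+ (κ :+ κ :+ κ :+ κ) := con (fromℕ 6) :* κ) refl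
      e₂ : ∀ κ → fromℕ 3 * κ + fromℕ 3 * κ ≡ fromℕ 6 * κ
      e₂ = solve 1 (λ κ → con (fromℕ 3) :* κ :+ con (fromℕ 3) :* κ := con (fromℕ 6) :* κ) refl
      e₃ : ∀ κ → fromℕ 3 * (κ + κ) ≡ fromℕ 6 * κ
      e₃ = solve 1 (λ κ → con (fromℕ 3) :* (κ :+ κ) := con (fromℕ 6) :* κ) refl
      e₄ : ∀ r h → (r + h) - r ≡ h
      e₄ = solve 2 (λ r h → (r :+ h) :- r := h) refl
      0≤κ = ℚ.<⇒≤ 0<κ
      0≤2κ = 0≤p+q 0≤κ 0≤κ
      2κ≤1 : κ + κ ≤ 1ℚ
      2κ≤1 = ℚ.≤-trans (≤-slack (0≤p+q (0≤p+q 0≤2κ 0≤κ) 0≤κ) (e₁ κ)) 6κ≤1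
      κ≤1 : κ ≤ 1ℚ
      κ≤1 = ℚ.≤-trans (≤-slack 0≤κ refl) 2κ≤1
      step : ∀ n → ∣ seq ‖ x ‖ n - 1ℚ ∣ < κ × + 1 / suc n ≤ κ → ∣ sumSq (λ i → seq (x i) n) - 1ℚ ∣ ≤ η
      step n (σ≈1′ , h≤κ) = ∣-∣≤-sandwich {σ * σ} {(σ + h) * (σ + h)} {X} {1ℚ}
          (subst (σ * σ ≤_) (∣sumSq∣ f) (sqrtApprox-lower n X))
          (subst (_≤ (σ + h) * (σ + h)) (∣sumSq∣ f) (ℚ.<⇒≤ (sqrtApprox-upper n X)))
          (ℚ.≤-trans (sq-near-1 {σ} κ≤1 σ≈1)
            (ℚ.≤-trans (≤-slack (0≤p*q (0≤fromℕ 3) 0≤κ) (e₂ κ)) 6κ≤η))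
          (ℚ.≤-trans (sq-near-1 {σ + h} 2κ≤1 (∣p-r∣≤ {σ + h} {σ} {1ℚ}
              (subst (λ z → ∣ z ∣ ≤ κ) (sym (e₄ σ h)) (subst (_≤ κ) (sym (ℚ.0≤p⇒∣p∣≡p 0≤h)) h≤κ)) σ≈1))
            (subst (_≤ η) (sym (e₃ κ)) 6κ≤η))
        where
        f : Vector ℚ m
        f i = seq (x i) n
        X = sumSq f
        σ = sqrtApprox n X
        h = + 1 / suc n
        0≤h = ℚ.<⇒≤ (0<1/ n)
        σ≈1 : ∣ σ - 1ℚ ∣ ≤ κ
        σ≈1 = subst (λ z → ∣ z - 1ℚ ∣ ≤ κ) (seq-‖‖ x n) (ℚ.<⇒≤ σ≈1′)
    build : Fraction 6 η →
            Eventually λ n → ∣ sumSq (λ i → seq (x i) n) - 1ℚ ∣ ≤ η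
    build (κ , 0<κ , 6κ≤η , 6κ≤1) = eventually-map (step κ 0<κ 6κ≤η 6κ≤1)
      (eventually-∩ (‖x‖≃1 κ 0<κ) (archimedean 0<κ))

  -- Since (1 - κ)² ≤ 1 - κ and 1 + κ ≤ (1 + κ)², the true root is within κ of 1; rounding costs at
  -- most another κ.
  sqrt-near-1 : ∀ n {q κ} → κ ≤ 1ℚ → + 1 / suc n ≤ κ → ∣ ∣ q ∣ - 1ℚ ∣ ≤ κ → ∣ sqrtApprox n q - 1ℚ ∣ ≤ κ + κ
  sqrt-near-1 n {q} {κ} κ≤1 h≤κ q≈1 = ∣p-q∣≤ {sqrtApprox n q} {1ℚ} {κ + κ}
    (ℚ.≤-trans (sqrtApprox≤ n (0≤p+q 0≤1 0≤κ) (ℚ.≤-trans (p≤q+r {∣ q ∣} {1ℚ} q≈1)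
        (≤-slack (0≤p+q 0≤κ (0≤p*q 0≤κ 0≤κ)) (e₁ κ))))
      (ℚ.+-monoʳ-≤ 1ℚ (≤-slack {κ} 0≤κ refl)))
    (≤-slack (0≤p+q (0≤q-p h≤κ) (0≤q-p (≤sqrtApprox+ n {1ℚ - κ} {q} (≤-slack
        (0≤p+q (0≤q-p (q≤p+r {∣ q ∣} {1ℚ} q≈1)) (0≤p*q 0≤κ (0≤q-p κ≤1))) (e₂ ∣ q ∣ κ)))))
      (e₃ (sqrtApprox n q) (+ 1 / suc n) κ))
    where
    0≤κ : 0ℚ ≤ κ
    0≤κ = ℚ.≤-trans (ℚ.<⇒≤ (0<1/ n)) h≤κ
    open +-*-Solver
    e₁ : ∀ κ → 1ℚ + κ + (κ + κ * κ) ≡ (1ℚ + κ) * (1ℚ + κ)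
    e₁ = solve 1 (λ κ → con 1ℚ :+ κ :+ (κ :+ κ :* κ) := (con 1ℚ :+ κ) :* (con 1ℚ :+ κ)) refl
    e₂ : ∀ q κ → (1ℚ - κ) * (1ℚ - κ) + ((q + κ - 1ℚ) + κ * (1ℚ - κ)) ≡ q
    e₂ = solve 2 (λ q κ → (con 1ℚ :- κ) :* (con 1ℚ :- κ)
                            :+ ((q :+ κ :- con 1ℚ) :+ κ :* (con 1ℚ :- κ)) := q) refl
    e₃ : ∀ σ h κ → 1ℚ + ((κ - h) + (σ + h - (1ℚ - κ))) ≡ σ + (κ + κ)
    e₃ = solve 3 (λ σ h κ → con 1ℚ :+ ((κ :- h) :+ (σ :+ h :- (con 1ℚ :- κ))) := σ :+ (κ :+ κ)) refl

  -- Makes the direction of the staircase an admissible target in `¬approximable-blocks`.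
  direction∈Sphere : ∀ {m} (a : Vector ℕ⁺ (suc m)) → direction a ∈ Sphere (suc m)
  direction∈Sphere {m} a = (λ i → 0≤dir i , dir≤1 i) , norm≃1
    where
    dir : ℕ → Vector ℚ (suc m)
    dir n i = val (a i) * scale a n
    0≤dir : ∀ i → ℝ.0ℝ ℝ.≤ direction a i
    0≤dir i ε 0<ε = eventually-map (λ n s>0 → subst (λ z → 0ℚ ≤ z + ε) (sym (seq-direction a i n))
        (0≤p+q (0≤p*q (0≤fromℕ (proj₁ (a i))) (ℚ.<⇒≤ (proj₁ (s>0 a)))) (ℚ.<⇒≤ 0<ε)))
      (scale-unit {m} 0<ε)
    dir≤1 : ∀ i → direction a i ℝ.≤ ℝ.1ℝ
    dir≤1 i ε 0<ε = eventually-map (λ n unit → subst (_≤ 1ℚ + ε) (sym (seq-direction a i n))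
        (p²-cancel-≤ (0≤p+q 0≤1 0≤ε) (ℚ.≤-trans (fᵢ²≤sumSq (dir n) i)
          (ℚ.≤-trans (p≤q+r {sumSq (dir n)} {1ℚ} (proj₂ (unit a)))
            (≤-slack (0≤p+q 0≤ε (0≤p*q 0≤ε 0≤ε)) (e ε))))))
      (scale-unit {m} 0<ε)
      where
      0≤ε = ℚ.<⇒≤ 0<ε
      open +-*-Solver
      e : ∀ κ → 1ℚ + κ + (κ + κ * κ) ≡ (1ℚ + κ) * (1ℚ + κ)
      e = solve 1 (λ κ → con 1ℚ :+ κ :+ (κ :+ κ :* κ) := (con 1ℚ :+ κ) :* (con 1ℚ :+ κ)) refl
    norm≃1 : ‖ direction a ‖ ℝ.≃ ℝ.1ℝ
    -- Of three κ, two bound the error of the norm and the third makes the inequality strict.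
    norm≃1 ε 0<ε = build (shrink 2 0<ε)
      where
      build : Fraction 3 ε →
              Eventually λ n → ∣ seq ‖ direction a ‖ n - 1ℚ ∣ < ε
      build (κ , 0<κ , 3κ≤ε , 3κ≤1) = eventually-map step
          (eventually-∩ (scale-unit {m} 0<κ) (archimedean 0<κ))
        where
        open +-*-Solver
        e : ∀ κ → κ + κ + κ ≡ fromℕ 3 * κ
        e = solve 1 (λ κ → κ :+ κ :+ κ := con (fromℕ 3) :* κ) refl
        e′ : ∀ κ → κ + (κ + κ) ≡ fromℕ 3 * κ
        e′ = solve 1 (λ κ → κ :+ (κ :+ κ) := con (fromℕ 3) :* κ) refl
        0≤κ = ℚ.<⇒≤ 0<κ
        κ≤1 : κ ≤ 1ℚ
        κ≤1 = ℚ.≤-trans (≤-slack (0≤p+q 0≤κ 0≤κ) (e′ κ)) 3κ≤1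
        2κ<ε : κ + κ < ε
        2κ<ε = ℚ.<-≤-trans (subst₂ _<_ (ℚ.+-identityʳ (κ + κ)) (e κ) (ℚ.+-monoʳ-< (κ + κ) 0<κ)) 3κ≤ε
        step : ∀ n → ScaleUnit (suc m) κ n × + 1 / suc n ≤ κ →
               ∣ seq ‖ direction a ‖ n - 1ℚ ∣ < ε
        step n (unit , h≤κ) = ℚ.≤-<-trans
          (subst (λ z → ∣ z - 1ℚ ∣ ≤ κ + κ) (sym eq)
            (sqrt-near-1 n {sumSq (dir n)} κ≤1 h≤κ
              (subst (λ z → ∣ z - 1ℚ ∣ ≤ κ) (sym (∣sumSq∣ (dir n))) (proj₂ (unit a)))))
          2κ<ε
          where
          eq : seq ‖ direction a ‖ n ≡ sqrtApprox n (sumSq (dir n))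
          eq = trans (seq-‖‖ (direction a) n)
            (cong (sqrtApprox n)
              (sumSq-cong (λ i → seq (direction a i) n) (dir n) (λ i → seq-direction a i n)))

  -- The multiplier `ρ` is left free: for (a) it is the scale of the longer vector, for (b) the grid
  -- width divided by the factor of a block.
  DirectionNear : ∀ {m} → Vector ℝ m → ℚ → ℚ → ℕ → Set
  DirectionNear {m} x δ ε n = (a : Vector ℕ⁺ m) (ρ : ℚ) → 0ℚ < ρ →
    (∀ i → ∣ val (a i) * ρ - seq (x i) n ∣ ≤ δ) → ∀ i → ∣ seq (direction a i) n - seq (x i) n ∣ ≤ ε

  -- A positive multiple of an integer vector that is close to a unit vector x
  -- has norm close to 1, so that normalising it changes little.
  direction-near : ∀ {m} {x : Vector ℝ (suc m)} → x ∈ Sphere (suc m) → ∀ {ε} → 0ℚ < ε →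
                   ∃[ δ ] 0ℚ < δ × Eventually (DirectionNear x δ ε)
  direction-near {m} {x} x∈S {ε} 0<ε = build₁ (shrink 12 0<ε)
    where
    Goal = ∃[ δ ] 0ℚ < δ × Eventually (DirectionNear x δ ε)
    build₁ : Fraction 13 ε → Goal
    build₁ (κ , 0<κ , 13κ≤ε , 13κ≤1) = build₂ (shrink (suc m ℕ.* 5) 0<κ)
      where
      build₂ : Fraction (suc (suc m ℕ.* 5)) κ → Goal
      build₂ (δ , 0<δ , Mδ≤κ , _) = δ , 0<δ ,
        eventually-map step (eventually-∩ (scale-unit {m} 0<κ) (sphere-unit {x = x} x∈S 0<δ))
        where
        step : ∀ n → ScaleUnit (suc m) κ n ×
                     ∣ sumSq (λ i → seq (x i) n) - 1ℚ ∣ ≤ δ → DirectionNear x δ ε n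
        step n (unit , x≈1) a ρ 0<ρ close i = ℚ.≤-trans
          (subst (λ z → ∣ z - seq (x i) n ∣ ≤ fromℕ 13 * κ) (trans (y*t≡ i) (sym (seq-direction a i n)))
            (rescale-close (λ j → seq (x j) n) (λ j → val (a j) * ρ) 0≤t (ℚ.<⇒≤ 0<δ) Mδ≤κ 13κ≤1 x≈1
              (subst (λ U → ∣ U - 1ℚ ∣ ≤ κ) (sym U≡) (proj₂ (unit a))) close i))
          13κ≤ε
          where
          s = scale a n
          -- Multiplication by `t` exchanges the multiplier `ρ` for the normalising scale `s`.
          t = s * recip ρ
          0≤t : 0ℚ ≤ t
          0≤t = 0≤p*q (ℚ.<⇒≤ (proj₁ (unit a))) (ℚ.<⇒≤ (0<recip 0<ρ))
          open +-*-Solver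
          regroup : ∀ v ρ s w → v * ρ * (s * w) ≡ v * s * (ρ * w)
          regroup = solve 4 (λ v ρ s w → v :* ρ :* (s :* w) := v :* s :* (ρ :* w)) refl
          y*t≡ : ∀ j → val (a j) * ρ * t ≡ val (a j) * s
          y*t≡ j = trans (regroup (val (a j)) ρ s (recip ρ))
            (trans (cong (_*_ (val (a j) * s)) (p*recip[p]≡1 0<ρ)) (ℚ.*-identityʳ _))
          U≡ : sumSq (λ j → val (a j) * ρ * t) ≡ sumSq (λ j → val (a j) * s)
          U≡ = sumSq-cong (λ j → val (a j) * ρ * t) (λ j → val (a j) * s) y*t≡

  -- Part (a): dropping a coordinate.

  0∷-∈Sphere : ∀ {m} {x : Vector ℝ m} → x ∈ Sphere m → (ℝ.0ℝ ∷ x) ∈ Sphere (suc m)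
  0∷-∈Sphere {m} {x} (bounds , ‖x‖≃1) = bounds′ ,
    λ ε 0<ε → eventually-map (λ n → subst (λ z → ∣ z - 1ℚ ∣ < ε) (sym (norm≡ n))) (‖x‖≃1 ε 0<ε)
    where
    bounds′ : ∀ i → ℝ.0ℝ ℝ.≤ (ℝ.0ℝ ∷ x) i × (ℝ.0ℝ ∷ x) i ℝ.≤ ℝ.1ℝ
    bounds′ zero    = (λ ε 0<ε → 0 , λ _ _ → 0≤p+q ℚ.≤-refl (ℚ.<⇒≤ 0<ε))
                    , (λ ε 0<ε → 0 , λ _ _ → 0≤p+q (ℚ.nonNegative⁻¹ 1ℚ) (ℚ.<⇒≤ 0<ε))
    bounds′ (suc i) = bounds i
    norm≡ : ∀ n → seq (‖ ℝ.0ℝ ∷ x ‖) n ≡ seq (‖ x ‖) n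
    norm≡ n = trans (seq-‖‖ (ℝ.0ℝ ∷ x) n) (trans
      (cong (sqrtApprox n) (ℚ.+-identityˡ (sumSq λ i → seq (x i) n))) (sym (seq-‖‖ x n)))

  approximable-pred : ∀ A {m} → Approximable A (suc (suc m)) → Approximable A (suc m)
  approximable-pred A {m} approx x x∈S ε 0<ε = build (direction-near {x = x} x∈S 0<ε)
    where
    build : (∃[ δ ] 0ℚ < δ × Eventually (DirectionNear x δ ε)) →
            ∃[ a ] (∀ i → a i ∈ A) × Near x ε (direction {suc m} a)
    build (δ , 0<δ , direction-close) =
      let a , a∈A , near = approx (ℝ.0ℝ ∷ x) (0∷-∈Sphere {x = x} x∈S) δ 0<δ
      in a ∘ suc , a∈A ∘ suc , eventually-map
           -- The scale of the whole vector `a` serves as the multiplier for its tail.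
           (λ n (close , norm , unit) → norm (a ∘ suc) (scale a n) (proj₁ (unit a))
             λ i → subst (λ z → ∣ z - seq (x i) n ∣ ≤ δ) (seq-direction a (suc i) n) (close (suc i)))
           (eventually-∩ near (eventually-∩ direction-close (scale-unit {suc m} 0<ε)))

  -- Positive rational points near the sphere.

  round-up : ∀ K p → - 1ℚ ≤ p → p < fromℕ K → ∃[ v ] p ≤ fromℕ (suc v) × fromℕ (suc v) ≤ p + fromℕ 2
  -- A negative `p` is rounded to 1, the least admissible value; as `p` is at least -1, this
  -- overshoots by at most 2.
  round-up zero p -1≤p p<0 = 0 , ℚ.≤-trans (ℚ.<⇒≤ p<0) (0≤fromℕ 1) , ℚ.+-monoˡ-≤ (fromℕ 2) -1≤p
  round-up (suc K) p -1≤p p<K with p <? fromℕ K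
  ... | yes p<K′ = round-up K p -1≤p p<K′
  ... | no  p≮K′ = K , ℚ.<⇒≤ p<K , ≤-slack (0≤p+q (0≤q-p (ℚ.≮⇒≥ p≮K′)) (0≤fromℕ 1))
      (trans (cong (λ z → z + ((p - fromℕ K) + 1ℚ)) (fromℕ-suc K)) (e p (fromℕ K)))
    where
    open +-*-Solver
    e : ∀ p k → 1ℚ + k + ((p - k) + 1ℚ) ≡ p + fromℕ 2
    e = solve 2 (λ p k → con 1ℚ :+ k :+ ((p :- k) :+ con 1ℚ) := p :+ con (fromℕ 2)) refl

  eventually-settled : ∀ (x : ℝ) {ε} → 0ℚ < ε → Eventually λ N → ∀ n → N ℕ.≤ n → ∣ seq x N - seq x n ∣ < ε
  eventually-settled x {ε} 0<ε = let N₀ , h = isCauchy x ε 0<ε in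
    N₀ , λ N N₀≤N n N≤n → h N n N₀≤N (ℕ.≤-trans N₀≤N N≤n)

  RationallyNear : ∀ {m} → Vector ℝ m → ℚ → Set
  RationallyNear {m} x δ = ∃[ ρ ] 0ℚ < ρ ×
    (Σ[ v ∈ (Fin m → ℕ) ] Eventually λ n → ∀ i → ∣ fromℕ (suc (v i)) * ρ - seq (x i) n ∣ ≤ δ)

  -- A term of each coordinate settled within δ/2 is rounded up to the grid of width h = 1 / (M +
  -- 1), where 2h ≤ δ/2. Grid points start at h, so that even a vanishing coordinate receives a
  -- positive numerator.
  rational-near : ∀ {m} (x : Vector ℝ m) → (∀ i → ℝ.0ℝ ℝ.≤ x i × x i ℝ.≤ ℝ.1ℝ) →
                  ∀ {δ} → 0ℚ < δ → RationallyNear x δ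
  rational-near {m} x bounds {δ} 0<δ = build (archimedean (0<½*p (0<½*p 0<δ)))
    where
    build : (Eventually λ M → + 1 / suc M ≤ ½ * (½ * δ)) → RationallyNear x δ
    build (M , small) = settle (eventually⇒∃ (eventually-∀ λ i →
        eventually-∩ (eventually-settled (x i) (0<½*p 0<δ))
          (eventually-∩ (proj₁ (bounds i) h (0<1/ M)) (proj₂ (bounds i) ½ 0<½))))
      where
      h = + 1 / suc M
      H = fromℕ (suc M)
      0≤H = 0≤fromℕ (suc M)
      settle : (∃[ N ] ∀ i → (∀ n → N ℕ.≤ n → ∣ seq (x i) N - seq (x i) n ∣ < ½ * δ) ×
                  (0ℚ ≤ seq (x i) N + h × seq (x i) N ≤ 1ℚ + ½)) → RationallyNear x δ
      settle (N , settled) = h , 0<1/ M , v , N , λ n N≤n i →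
        subst (∣ fromℕ (suc (v i)) * h - seq (x i) n ∣ ≤_) (½*p+½*p≡p δ)
          (∣p-r∣≤ {fromℕ (suc (v i)) * h} {seq (x i) N} {seq (x i) n}
            (v-close i) (ℚ.<⇒≤ (proj₁ (settled i) n N≤n)))
        where
        y : Fin m → ℚ
        y i = seq (x i) N
        open +-*-Solver
        -- A nonnegative real has late terms at least -h, and h H = 1.
        -1≤yH : ∀ i → - 1ℚ ≤ y i * H
        -1≤yH i = ≤-slack (0≤p*q (proj₁ (proj₂ (settled i))) 0≤H)
          (trans (e (y i) h H) (trans (cong (λ z → - 1ℚ + (y i * H + z)) (fromℕ*1/ M)) (e′ (y i * H))))
          where
          e : ∀ y h H → - 1ℚ + (y + h) * H ≡ - 1ℚ + (y * H + H * h)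
          e = solve 3 (λ y h H → con (- 1ℚ) :+ (y :+ h) :* H := con (- 1ℚ) :+ (y :* H :+ H :* h)) refl
          e′ : ∀ z → - 1ℚ + (z + 1ℚ) ≡ z
          e′ = solve 1 (λ z → con (- 1ℚ) :+ (z :+ con 1ℚ) := z) refl
        -- Starting point of the search in `round-up`: late terms of a real at most 1 are at most 1
        -- + ½, which is below 2.
        yH< : ∀ i → y i * H < fromℕ (2 ℕ.* suc M)
        yH< i = subst (y i * H <_) (sym (fromℕ-* 2 (suc M)))
          (ℚ.*-monoˡ-<-pos H {{positive 0<H}} {y i} {fromℕ 2} y<2)
          where
          y<2 : y i < fromℕ 2
          y<2 = ℚ.≤-<-trans {y i} {1ℚ + ½} {fromℕ 2} (proj₂ (proj₂ (settled i)))
            (ℚ.+-monoʳ-< 1ℚ {½} {1ℚ} (*<* (ℤ.+<+ (ℕ.s≤s (ℕ.s≤s ℕ.z≤n)))))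
          0<H : 0ℚ < H
          0<H = ℚ.<-≤-trans (ℚ.positive⁻¹ 1ℚ) (fromℕ-mono-≤ 1 (suc M) (ℕ.s≤s ℕ.z≤n))
        rounded : ∀ i → ∃[ v ] y i * H ≤ fromℕ (suc v) × fromℕ (suc v) ≤ y i * H + fromℕ 2
        rounded i = round-up (2 ℕ.* suc M) (y i * H) (-1≤yH i) (yH< i)
        v : Fin m → ℕ
        v i = proj₁ (rounded i)
        v-close : ∀ i → ∣ fromℕ (suc (v i)) * h - y i ∣ ≤ ½ * δ
        v-close i = subst (λ z → ∣ z ∣ ≤ ½ * δ)
          (trans (e V (y i) h H) (trans (cong (λ z → V * h - y i * z) (fromℕ*1/ M))
            (cong (λ z → V * h - z) (ℚ.*-identityʳ (y i)))))
          (ℚ.≤-trans (∣p*q∣≤ {V - y i * H} {h} {fromℕ 2} {½ * (½ * δ)}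
              (∣p-q∣≤ {V} {y i * H} {fromℕ 2} (proj₂ (proj₂ (rounded i)))
                (ℚ.≤-trans (proj₁ (proj₂ (rounded i))) (≤-slack (0≤fromℕ 2) refl)))
              (subst (_≤ ½ * (½ * δ)) (sym (ℚ.0≤p⇒∣p∣≡p (ℚ.<⇒≤ (0<1/ M)))) (small M ℕ.≤-refl)))
            (ℚ.≤-reflexive (e′ δ)))
          where
          V = fromℕ (suc (v i))
          e : ∀ V y h H → (V - y * H) * h ≡ V * h - y * (H * h)
          e = solve 4 (λ V y h H → (V :- y :* H) :* h := V :* h :- y :* (H :* h)) refl
          e′ : ∀ δ → fromℕ 2 * (½ * (½ * δ)) ≡ ½ * δ
          e′ = solve 1 (λ δ → con (fromℕ 2) :* (con ½ :* (con ½ :* δ)) := con ½ :* δ) refl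

  -- Part (b): density of the block directions.

  approximable-blocks : ∀ m C {{_ : ℕ.NonZero C}} → Approximable (blocks (suc m) C) (suc m)
  approximable-blocks m C x x∈S ε 0<ε = build (direction-near {x = x} x∈S 0<ε)
    where
    Goal = ∃[ a ] (∀ i → a i ∈ blocks (suc m) C) × Near x ε (direction {suc m} a)
    build : (∃[ δ ] 0ℚ < δ × Eventually (DirectionNear x δ ε)) → Goal
    build (δ , 0<δ , direction-close) = build′ (rational-near x (proj₁ x∈S) 0<δ)
      where
      build′ : RationallyNear x δ → Goal
      build′ (ρ , 0<ρ , v , near) = blockPoint (suc m) C v , blockPoint∈blocks (suc m) C v , eventually-map
        -- The block point is `T` times the vector of grid numerators, so dividing the grid width
        -- `ρ` by `T` recovers the grid point.
        (λ n (close , norm) → norm (blockPoint (suc m) C v) (ρ * recip T) (0<p*q 0<ρ (0<recip 0<T))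
          λ i → subst (λ z → ∣ z - seq (x i) n ∣ ≤ δ) (sym (rescale i)) (close i))
        (eventually-∩ near direction-close)
        where
        t = base (suc m) C (encode v)
        T = fromℕ t
        0<T : 0ℚ < T
        0<T = ℚ.<-≤-trans (ℚ.positive⁻¹ 1ℚ) (1≤val (t , base-nonZero (suc m) C (encode v)))
        open +-*-Solver
        e : ∀ T V ρ w → T * V * (ρ * w) ≡ V * ρ * (T * w)
        e = solve 4 (λ T V ρ w → T :* V :* (ρ :* w) := V :* ρ :* (T :* w)) refl
        rescale : ∀ i → val (blockPoint (suc m) C v i) * (ρ * recip T) ≡ fromℕ (suc (v i)) * ρ
        rescale i = trans (cong (_* (ρ * recip T)) (fromℕ-* t (suc (v i))))
          (trans (e T (fromℕ (suc (v i))) ρ (recip T))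
            (trans (cong (_*_ (fromℕ (suc (v i)) * ρ)) (p*recip[p]≡1 0<T)) (ℚ.*-identityʳ _)))

  -- Part (b): failure of density with one more coordinate.

  staircase : ∀ m → Vector ℕ⁺ m
  staircase m i = suc (Fin.toℕ i) , _

  -- The direction of (1, ..., m + 1) is the arithmetic progression of step s′ starting at s′.
  -- Errors below s′/2 preserve its strict growth and keep the ratios below `C`, which `no-spread`
  -- rules out.
  ¬approximable-blocks : ∀ m → ¬ Approximable (blocks m (2 ℕ.* suc (suc m))) (suc m)
  ¬approximable-blocks m approx = impossible (scale-bounded-below (staircase (suc m)))
    where
    C = 2 ℕ.* suc (suc m)
    w = staircase (suc m)
    open +-*-Solver
    impossible : ¬ (∃[ c ] 0ℚ < c × Eventually λ n → c ≤ scale w n)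
    impossible (c , 0<c , c≤) = refute (approx (direction w) (direction∈Sphere w) δ 0<δ)
      where
      -- A quarter of the lower bound of s′, so that 2δ < s′ at all late stages.
      δ = ½ * (½ * c)
      0<δ = 0<½*p (0<½*p 0<c)
      refute : ¬ (∃[ a ] (∀ i → a i ∈ blocks m C) × Near (direction w) δ (direction {suc m} a))
      refute (a , a∈A , near) = at (eventually⇒∃ (eventually-∩ near (eventually-∩ c≤ (scale-unit {m} 0<c))))
        where
        at : ¬ (∃[ n ] (∀ i → ∣ seq (direction a i) n - seq (direction w i) n ∣ ≤ δ) × c ≤ scale w n ×
                 ScaleUnit (suc m) c n)
        at (n , close , c≤s′ , unit) = no-spread m C a a∈A bounded increasing
          where
          s = scale a n
          s′ = scale w n
          0<s = proj₁ (unit a)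
          0≤s = ℚ.<⇒≤ 0<s
          0<s′ = ℚ.<-≤-trans 0<c c≤s′
          0≤s′ = ℚ.<⇒≤ 0<s′
          2δ<s′ : δ + δ < s′
          2δ<s′ = ℚ.<-≤-trans (subst₂ _<_ (trans (ℚ.+-identityʳ _) (sym (½*p+½*p≡p (½ * c)))) (½*p+½*p≡p c)
            (ℚ.+-monoʳ-< (½ * c) (0<½*p 0<c))) c≤s′
          close′ : ∀ i → ∣ val (a i) * s - val (w i) * s′ ∣ ≤ δ
          close′ i = subst₂ (λ p q → ∣ p - q ∣ ≤ δ) (seq-direction a i n) (seq-direction w i n) (close i)
          a≤ : ∀ i → val (a i) * s ≤ val (w i) * s′ + δ
          a≤ i = p≤q+r {val (a i) * s} {val (w i) * s′} (close′ i)
          ≤a : ∀ i → val (w i) * s′ ≤ val (a i) * s + δ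
          ≤a i = q≤p+r {val (a i) * s} {val (w i) * s′} (close′ i)
          increasing : ∀ i j → i Fin.< j → proj₁ (a i) ℕ.< proj₁ (a j)
          increasing i j i<j = fromℕ-cancel-< (proj₁ (a i)) (proj₁ (a j))
            (ℚ.*-cancelʳ-<-nonNeg s {{nonNegative 0≤s}} (begin-strict
              val (a i) * s                  ≤⟨ a≤ i ⟩
              val (w i) * s′ + δ             ≡⟨ e₁ (val (w i) * s′) δ ⟩
              val (w i) * s′ + (δ + δ) - δ   <⟨ ℚ.+-monoˡ-< (- δ) (ℚ.+-monoʳ-< (val (w i) * s′) 2δ<s′) ⟩
              val (w i) * s′ + s′ - δ        ≡⟨ e₂ (val (w i)) s′ δ ⟩
              (1ℚ + val (w i)) * s′ - δ      ≤⟨ ℚ.+-monoˡ-≤ (- δ) next-step ⟩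
              val (w j) * s′ - δ             ≤⟨ ℚ.+-monoˡ-≤ (- δ) (≤a j) ⟩
              val (a j) * s + δ - δ          ≡⟨ e₃ (val (a j) * s) δ ⟩
              val (a j) * s                  ∎))
            where
            open ℚ.≤-Reasoning
            next-step : (1ℚ + val (w i)) * s′ ≤ val (w j) * s′
            next-step = ℚ.*-monoʳ-≤-nonNeg s′ {{nonNegative 0≤s′}}
              (subst (_≤ val (w j)) (fromℕ-suc (suc (Fin.toℕ i)))
                (fromℕ-mono-≤ (suc (suc (Fin.toℕ i))) (suc (Fin.toℕ j)) (ℕ.s≤s i<j)))
            e₁ : ∀ p δ → p + δ ≡ p + (δ + δ) - δ
            e₁ = solve 2 (λ p δ → p :+ δ := p :+ (δ :+ δ) :- δ) refl
            e₂ : ∀ v s δ → v * s + s - δ ≡ (1ℚ + v) * s - δ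
            e₂ = solve 3 (λ v s δ → v :* s :+ s :- δ := (con 1ℚ :+ v) :* s :- δ) refl
            e₃ : ∀ p δ → p + δ - δ ≡ p
            e₃ = solve 2 (λ p δ → p :+ δ :- δ := p) refl
          δ<s′ : δ < s′
          δ<s′ = ℚ.≤-<-trans (≤-slack {δ} (ℚ.<⇒≤ 0<δ) refl) 2δ<s′
          -- Each a i s is below (m + 1) s′ + s′, and each a j s is at least s′ - δ, hence at least
          -- s′/2. This explains C = 2 (m + 2).
          bounded : ∀ i j → proj₁ (a i) ℕ.< C ℕ.* proj₁ (a j)
          bounded i j = fromℕ-cancel-< (proj₁ (a i)) (C ℕ.* proj₁ (a j))
            (ℚ.*-cancelʳ-<-nonNeg s {{nonNegative 0≤s}} (begin-strict
              val (a i) * s                    ≤⟨ a≤ i ⟩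
              val (w i) * s′ + δ               <⟨ ℚ.+-mono-≤-< w≤ δ<s′ ⟩
              fromℕ (suc m) * s′ + s′          ≡⟨ e₁ (fromℕ (suc m)) s′ ⟩
              (1ℚ + fromℕ (suc m)) * s′        ≡⟨ cong (_* s′) (sym (fromℕ-suc (suc m))) ⟩
              K * s′                           ≤⟨ ℚ.*-monoˡ-≤-nonNeg K {{nonNegative (0≤fromℕ (suc (suc m)))}} s′≤ ⟩
              K * (fromℕ 2 * (val (a j) * s))  ≡⟨ e₂ K (val (a j)) s ⟩
              fromℕ 2 * K * val (a j) * s      ≡⟨ cong (λ z → z * val (a j) * s) (sym (fromℕ-* 2 (suc (suc m)))) ⟩
              fromℕ C * val (a j) * s          ≡⟨ cong (_* s) (sym (fromℕ-* C (proj₁ (a j)))) ⟩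
              fromℕ (C ℕ.* proj₁ (a j)) * s    ∎))
            where
            open ℚ.≤-Reasoning
            K = fromℕ (suc (suc m))
            w≤ : val (w i) * s′ ≤ fromℕ (suc m) * s′
            w≤ = ℚ.*-monoʳ-≤-nonNeg s′ {{nonNegative 0≤s′}}
              (fromℕ-mono-≤ (suc (Fin.toℕ i)) (suc m) (Fin.toℕ<n i))
            e₁ : ∀ k s → k * s + s ≡ (1ℚ + k) * s
            e₁ = solve 2 (λ k s → k :* s :+ s := (con 1ℚ :+ k) :* s) refl
            e₂ : ∀ K v s → K * (fromℕ 2 * (v * s)) ≡ fromℕ 2 * K * v * s
            e₂ = solve 3 (λ K v s → K :* (con (fromℕ 2) :* (v :* s)) := con (fromℕ 2) :* K :* v :* s) refl
            e₃ : ∀ s p δ → s + ((s - (δ + δ)) + ((p + δ - s) + (p + δ - s))) ≡ fromℕ 2 * p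
            e₃ = solve 3 (λ s p δ → s :+ ((s :- (δ :+ δ)) :+ ((p :+ δ :- s) :+ (p :+ δ :- s)))
                                      := con (fromℕ 2) :* p) refl
            s′≤as+δ : s′ ≤ val (a j) * s + δ
            s′≤as+δ = ℚ.≤-trans (subst (_≤ val (w j) * s′) (ℚ.*-identityˡ s′)
              (ℚ.*-monoʳ-≤-nonNeg s′ {{nonNegative 0≤s′}} (1≤val (w j)))) (≤a j)
            s′≤ : s′ ≤ fromℕ 2 * (val (a j) * s)
            s′≤ = ≤-slack (0≤p+q (0≤q-p (ℚ.<⇒≤ 2δ<s′)) (0≤p+q (0≤q-p s′≤as+δ) (0≤q-p s′≤as+δ)))
              (e₃ s′ (val (a j) * s) δ)

-- Both parts, from approximability back to density.

open import Data.Nat using (ℕ; suc; _≤_; _∸_; s≤s; _*_)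
open import Data.Product using (_×_; _,_; Σ-syntax)
open Approximation
open Blocks using (blocks)

theorem1p4 : ∀ (k : ℕ) → 3 ≤ k →
    (∀ (A : Pred ℕ⁺ 0ℓ) → D k A IsDenseIn Sphere k → D (k ∸ 1) A IsDenseIn Sphere (k ∸ 1))
    × (Σ[ A ∈ Pred ℕ⁺ 0ℓ ] (¬ (D k A IsDenseIn Sphere k) × D (k ∸ 1) A IsDenseIn Sphere (k ∸ 1)))
theorem1p4 (suc (suc m)) (s≤s (s≤s _)) =
    (λ A dense → approximable⇒dense A (approximable-pred A (dense⇒approximable A dense)))
  , blocks (suc m) C
  , (λ dense → ¬approximable-blocks (suc m) (dense⇒approximable (blocks (suc m) C) dense))
  , approximable⇒dense (blocks (suc m) C) (approximable-blocks m C)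
  where
  C : ℕ
  -- The ratio bound of `¬approximable-blocks` for k = m + 2 entries, that is 2 (k + 1); the density
  -- of the blocks holds for every nonzero `C`.
  C = 2 * suc (suc (suc m))
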